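{- Let $A_T$ be an $s\times k$ matrix with nonnegative integer entries, representing a linear map $T : \mathbb N^k \to \mathbb N^s$, and consider contingency tables $\mathbf n \in \mathbb N^k$ with cell set $\mathcal X = \{1,\dots,k\}$ in a bounded fiber $\mathcal F_T^{\mathbf b}$ under the bound $\mathbf n \le \mathbf b$. Let $\mathcal X_0 \subset \mathcal X$ be the set of structural zeros, let $\mathcal X' = \mathcal X\setminus \mathcal X_0$, let $T'$ be the restriction of $T$ to $\mathcal X'$ (so that $A_{T'}$ is the submatrix of $A_T$ formed by the columns indexed by $\mathcal X'$), let $\mathcal I_{A_T} \subset \mathbb R[x_h : h \in \mathcal X]$ be the toric ideal of $A_T$, and let $\mathcal I'_{A_T}\subset \mathbb R[x_h : h\in \mathcal X']$ be the toric ideal of $A_{T'}$. Then a Universal Gröbner basis for the ideal $\mathcal I'_{A_T}$ is obtained from the Universal Gröbner basis of $\mathcal I_{A_T}$ by removing the binomials that involve at least one indeterminate $x_h$ with $h \in \mathcal X_0$.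
   Context: $\mathbb N=\{0,1,2,\dots\}$. For $\mathbf b\in\mathbb N^k$ and an observed table $\mathbf n_{\mathrm{obs}}$, the bounded fiber is $\mathcal F_T^{\mathbf b} = \{\mathbf n \in \mathbb N^k : A_T\mathbf n = A_T \mathbf n_{\mathrm{obs}},\ \mathbf n \le \mathbf b\}$ (componentwise inequality). Structural zeros are cells whose count is constrained to be $0$ (upper bound $0$). Toric ideal: for a nonnegative integer matrix $A$ with rows indexed by $\ell=1,\dots,s$ and columns indexed by a finite set $\mathcal Y$, $\mathcal I_A \subset \mathbb R[x_h: h\in\mathcal Y]$ is the elimination ideal $\langle x_h - \prod_{\ell=1}^s y_\ell^{A(\ell,h)} : h\in \mathcal Y\rangle \cap \mathbb R[x_h : h\in\mathcal Y]$, where the ideal on the left lives in $\mathbb R[x_h, y_\ell]$. Universal Gröbner basis (the convention used here): for a matrix $A$ of size $s \times k$, let its Lawrence lifting be the $(s+k)\times(2k)$ matrix $$\Lambda(A) = \begin{pmatrix} A & 0\\ I_k & I_k\end{pmatrix},$$ whose columns correspond to indeterminates $x_1,\dots,x_k,\overline x_1,\dots,\overline x_k$. The Universal Gröbner basis of $\mathcal I_A$ is the set of binomials obtained by taking the reduced Gröbner basis of the toric ideal $\mathcal I_{\Lambda(A)} \subset \mathbb R[\mathbf x,\overline{\mathbf x}]$ (for this type of matrix it is, up to signs of its elements, independent of the term order) and substituting $\overline x_h = 1$ for all $h$. It is a set of binomials $\mathbf x^{a} - \mathbf x^{b}$, regarded up to sign, and is a Gröbner basis of $\mathcal I_A$ with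 respect to every term order. The same definition is applied to $A_{T'}$ with index set $\mathcal X'$. -}

module Defs where

open import Algebra.Apartness.Bundles using (HeytingField; HeytingCommutativeRing)
open import Algebra.Bundles using (CommutativeRing)
import Algebra.Definitions.RawMonoid as RawMonoidDefinitions
open import Data.Bool.Base using (if_then_else_)
open import Data.Fin.Base using (Fin)
open import Data.Fin.Subset using (Subset; inside; outside; ∣_∣; _∈_; ∁)
open import Data.List.Base as List using (List; []; _∷_)
open import Data.Nat.Base as ℕ using (ℕ)
import Data.Nat.Properties as ℕ
open import Data.Product.Base using (∃; ∃-syntax; _×_; _,_; map₁; map₂)
open import Data.Sum.Base using (_⊎_)
open import Data.Vec.Base as Vec using (Vec; []; _∷_; _++_; _[_]≔_)
open import Data.Vec.Properties using (≡-dec)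

open import Function.Bundles using (_⇔_)
open import Level using (Level; _⊔_; suc)
open import Relation.Binary.Core using (Rel)
open import Relation.Binary.PropositionalEquality.Core using (_≡_; _≢_)
open import Relation.Binary.Structures using (IsStrictPartialOrder; IsStrictTotalOrder)
open import Relation.Nullary.Decidable.Core using (does)
open import Relation.Nullary.Negation.Core using (¬_)
open import Relation.Unary using (Pred; _≐_)

-- The library has no real numbers, so ℝ is given by its axioms: a
-- Cauchy-complete Archimedean ordered field.  Classically these determine
-- ℝ up to isomorphism.

record RealField c ℓ₁ ℓ₂ ℓ₃ : Set (suc (c ⊔ ℓ₁ ⊔ ℓ₂ ⊔ ℓ₃)) where
  field
    heytingField : HeytingField c ℓ₁ ℓ₂

  open HeytingField heytingField public
  open CommutativeRing (HeytingCommutativeRing.commutativeRing heytingCommutativeRing)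
    using (+-rawMonoid)
  open RawMonoidDefinitions +-rawMonoid public using () renaming (_×_ to _×ℕ_)

  infix 4 _<_

  field
    _<_                  : Rel Carrier ℓ₃
    isStrictPartialOrder : IsStrictPartialOrder _≈_ _<_
    #⇔<⊎>                : ∀ x y → x # y ⇔ (x < y ⊎ y < x)
    +-monoˡ-<            : ∀ {x y} z → x < y → x + z < y + z
    *-pos                : ∀ {x y} → 0# < x → 0# < y → 0# < x * y
    archimedean          : ∀ x → ∃[ n ] x < n ×ℕ 1#

  Close : Carrier → Carrier → Carrier → Set ℓ₃
  Close ε x y = (x - y < ε) × (y - x < ε)

  Cauchy : (ℕ → Carrier) → Set (c ⊔ ℓ₃)
  Cauchy a = ∀ ε → 0# < ε → ∃[ N ] (∀ i j → N ℕ.≤ i → N ℕ.≤ j → Close ε (a i) (a j))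

  ConvergesTo : (ℕ → Carrier) → Carrier → Set (c ⊔ ℓ₃)
  ConvergesTo a x = ∀ ε → 0# < ε → ∃[ N ] (∀ i → N ℕ.≤ i → Close ε (a i) x)

  field
    complete : ∀ a → Cauchy a → ∃[ x ] ConvergesTo a x

-- The monomial x₁^(a₁) ⋯ xₙ^(aₙ) is its exponent vector.

Monomial : ℕ → Set
Monomial n = Vec ℕ n

𝟙 : ∀ {n} → Monomial n
𝟙 = Vec.replicate _ 0

infixl 7 _·_
_·_ : ∀ {n} → Monomial n → Monomial n → Monomial n
_·_ = Vec.zipWith ℕ._+_

unit : ∀ {n} → Fin n → Vec ℕ n
unit h = Vec.replicate _ 0 [ h ]≔ 1

record TermOrder (n : ℕ) (ℓ : Level) : Set (suc ℓ) where
  infix 4 _≺_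
  field
    _≺_                : Rel (Monomial n) ℓ
    isStrictTotalOrder : IsStrictTotalOrder _≡_ _≺_
    ·-monoʳ-≺          : ∀ t {m m′} → m ≺ m′ → t · m ≺ t · m′
    𝟙-least            : ∀ {m} → m ≢ 𝟙 → 𝟙 ≺ m

Matrix : ℕ → ℕ → Set
Matrix s k = Vec (Vec ℕ k) s

column : ∀ {s k} → Matrix s k → Fin k → Vec ℕ s
column A h = Vec.map (λ row → Vec.lookup row h) A

identity : ∀ k → Matrix k k
identity k = Vec.tabulate unit

lawrence : ∀ {s k} → Matrix s k → Matrix (s ℕ.+ k) (k ℕ.+ k)
lawrence {_} {k} A =
  Vec.map (λ row → row ++ Vec.replicate k 0) A ++
  Vec.map (λ row → row ++ row) (identity k)

structuralZeros : ∀ {k} → Vec ℕ k → Subset k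
structuralZeros = Vec.map (λ u → does (u ℕ.≟ 0))

-- The elements of a subset p are numbered, in increasing order, by
-- Fin ∣ p ∣.  restrict keeps the entries indexed by p; extend is its
-- section filling the other entries with 0.

restrict : ∀ {a} {A : Set a} {k} (p : Subset k) → Vec A k → Vec A ∣ p ∣
restrict []            []       = []
restrict (inside  ∷ p) (x ∷ xs) = x ∷ restrict p xs
restrict (outside ∷ p) (x ∷ xs) = restrict p xs

extend : ∀ {k} (p : Subset k) → Monomial ∣ p ∣ → Monomial k
extend []            []       = []
extend (inside  ∷ p) (a ∷ as) = a ∷ extend p as
extend (outside ∷ p) as       = 0 ∷ extend p as

submatrix : ∀ {s k} (p : Subset k) → Matrix s k → Matrix s ∣ p ∣
submatrix p = Vec.map (restrict p)

module Polynomials {c ℓ₁ ℓ₂} (K : HeytingField c ℓ₁ ℓ₂) where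

  open HeytingField K using (Carrier; 0#; 1#)
    renaming (_≈_ to _≈ᴷ_; _#_ to _#ᴷ_; _+_ to _+ᴷ_; _*_ to _*ᴷ_; -_ to -ᴷ_)

  -- A polynomial is a formal sum of terms, in which a monomial may occur
  -- several times; two polynomials are equal when all coefficients agree.

  Polynomial : ℕ → Set c
  Polynomial n = List (Carrier × Monomial n)

  coeff : ∀ {n} → Polynomial n → Monomial n → Carrier
  coeff []             m = 0#
  coeff ((a , m′) ∷ f) m = (if does (≡-dec ℕ._≟_ m′ m) then a else 0#) +ᴷ coeff f m

  infix 4 _≈_
  _≈_ : ∀ {n} → Rel (Polynomial n) ℓ₁
  f ≈ g = ∀ m → coeff f m ≈ᴷ coeff g m

  term : ∀ {n} → Carrier → Monomial n → Polynomial n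
  term a m = List.[ a , m ]

  infixl 6 _+_
  infixl 7 _*_
  infix  8 -_

  _+_ : ∀ {n} → Polynomial n → Polynomial n → Polynomial n
  _+_ = List._++_

  -_ : ∀ {n} → Polynomial n → Polynomial n
  -_ = List.map (map₁ -ᴷ_)

  _*_ : ∀ {n} → Polynomial n → Polynomial n → Polynomial n
  _*_ = List.cartesianProductWith λ (a , m) (b , m′) → (a *ᴷ b , m · m′)

  -- The ring homomorphism induced by a homomorphism of the monoids of
  -- monomials.
  mapMonomials : ∀ {n n′} → (Monomial n → Monomial n′) → Polynomial n → Polynomial n′
  mapMonomials φ = List.map (map₂ φ)

  -- The ideal generated by S.
  data ⟨_⟩ {n ℓ} (S : Pred (Polynomial n) ℓ) : Pred (Polynomial n) (c ⊔ ℓ₁ ⊔ ℓ) where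
    generator : ∀ {f} → S f → ⟨ S ⟩ f
    resp      : ∀ {f g} → f ≈ g → ⟨ S ⟩ f → ⟨ S ⟩ g
    zero      : ⟨ S ⟩ []
    add       : ∀ {f g} → ⟨ S ⟩ f → ⟨ S ⟩ g → ⟨ S ⟩ (f + g)
    multiply  : ∀ {f} g → ⟨ S ⟩ f → ⟨ S ⟩ (g * f)

  -- In K[x₁,…,xₙ,y₁,…,yₛ]: the polynomials x_h - ∏_ℓ y_ℓ^A(ℓ,h).
  toricGenerators : ∀ {s n} → Matrix s n → Pred (Polynomial (n ℕ.+ s)) ℓ₁
  toricGenerators A f =
    ∃[ h ] f ≈ term 1# (unit h ++ 𝟙) + (- term 1# (𝟙 ++ column A h))

  toricIdeal : ∀ {s n} → Matrix s n → Pred (Polynomial n) (c ⊔ ℓ₁)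
  toricIdeal A f = ⟨ toricGenerators A ⟩ (mapMonomials (_++ 𝟙) f)

  module _ {n ℓ} (order : TermOrder n ℓ) where
    open TermOrder order using (_≺_)

    IsLeadingMonomial : Polynomial n → Monomial n → Set (ℓ₁ ⊔ ℓ₂ ⊔ ℓ)
    IsLeadingMonomial f m =
      coeff f m #ᴷ 0# × (∀ m′ → m ≺ m′ → coeff f m′ ≈ᴷ 0#)

    leadingTerms : ∀ {ℓ′} → Pred (Polynomial n) ℓ′ →
                   Pred (Polynomial n) (c ⊔ ℓ₁ ⊔ ℓ₂ ⊔ ℓ ⊔ ℓ′)
    leadingTerms S t =
      ∃[ f ] ∃[ m ] S f × IsLeadingMonomial f m × t ≈ term (coeff f m) m

    record IsGröbnerBasis {ℓ′ r} (I : Pred (Polynomial n) ℓ′) (G : Fin r → Polynomial n) :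
                          Set (c ⊔ ℓ₁ ⊔ ℓ₂ ⊔ ℓ ⊔ ℓ′) where
      field
        members       : ∀ i → I (G i)
        initial-ideal : ⟨ leadingTerms I ⟩ ≐ ⟨ leadingTerms (λ f → ∃[ i ] f ≈ G i) ⟩

    record IsReducedGröbnerBasis {ℓ′ r} (I : Pred (Polynomial n) ℓ′)
                                 (G : Fin r → Polynomial n) :
                                 Set (c ⊔ ℓ₁ ⊔ ℓ₂ ⊔ ℓ ⊔ ℓ′) where
      field
        isGröbnerBasis : IsGröbnerBasis I G
        monic          : ∀ i → ∃[ m ] IsLeadingMonomial (G i) m × coeff (G i) m ≈ᴷ 1#
        reduced        : ∀ i m → coeff (G i) m #ᴷ 0# →
                         ¬ ⟨ leadingTerms (λ f → ∃[ j ] j ≢ i × f ≈ G j) ⟩ (term 1# m)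

  -- Substitution of 1 for the last k of the 2k indeterminates.
  dehomogenize : ∀ {k} → Polynomial (k ℕ.+ k) → Polynomial k
  dehomogenize {k} = mapMonomials (Vec.take k)

  -- A set of polynomials regarded up to sign is represented by the set of
  -- all its elements with both signs.
  IsUniversalGröbnerBasis : ∀ {s k ℓ ℓ′} → Matrix s k → TermOrder (k ℕ.+ k) ℓ →
                            Pred (Polynomial k) ℓ′ → Set (c ⊔ ℓ₁ ⊔ ℓ₂ ⊔ ℓ ⊔ ℓ′)
  IsUniversalGröbnerBasis {k = k} A order U =
    ∃[ r ] ∃ λ (G : Fin r → Polynomial (k ℕ.+ k)) →
      IsReducedGröbnerBasis order (toricIdeal (lawrence A)) G ×
      (∀ f → U f ⇔ (∃[ i ] (f ≈ dehomogenize (G i) ⊎ f ≈ - dehomogenize (G i))))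

  Involves : ∀ {k} → Polynomial k → Fin k → Set ℓ₂
  Involves f h = ∃[ m ] coeff f m #ᴷ 0# × 0 ℕ.< Vec.lookup m h

  -- What remains of U lies in K[x_h : h ∉ X₀] and is regarded as a subset
  -- of that ring.
  removeInvolving : ∀ {k ℓ} (X₀ : Subset k) → Pred (Polynomial k) ℓ →
                    Pred (Polynomial ∣ ∁ X₀ ∣) (c ⊔ ℓ₁ ⊔ ℓ₂ ⊔ ℓ)
  removeInvolving X₀ U f′ =
    ∃[ f ] U f × ¬ (∃[ h ] h ∈ X₀ × Involves f h) × f ≈ mapMonomials (extend (∁ X₀)) f′

{-# OPTIONS --safe #-}

-- In an element of the Lawrence ideal, each term has a partner of the same
-- degree, and up to a common factor two such terms are (u , v) and (v , u),
-- i.e. x^u x̄^v and x^v x̄^u, with A u = A v.  Hence the elements of a reduced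
-- Gröbner basis are binomials x^u x̄^v − x^v x̄^u, every such pair (u , v) is
-- divisible by one from the basis up to swapping, and no pair of the basis
-- divides another.  These properties characterise reduced Gröbner bases for
-- every term order, which only decides the orientation of each pair.  They pass
-- to the pairs supported in X′, because a divisor of a pair supported in X′ is
-- itself supported in X′.

module Submission where

open import Algebra.Apartness.Bundles using (HeytingField; HeytingCommutativeRing)
open import Algebra.Bundles using (CommutativeRing)
open import Defs
open import Data.Bool.Base using (if_then_else_)
open import Data.Fin.Base using (Fin; zero; suc)
import Data.Fin.Properties as Fin
open import Data.Fin.Subset using (Subset; inside; outside; ∣_∣; _∈_; ∁)
open import Data.List.Base as List using (List; []; _∷_)
import Data.List.Properties as List
open import Data.Nat.Base as ℕ using (ℕ; zero; suc; s≤s; z≤n)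
import Data.Nat.Properties as ℕ
open import Data.Product.Base as Product using (∃; ∃-syntax; ∃₂; _×_; _,_; proj₁; proj₂; swap)
open import Data.Sum.Base as Sum using (_⊎_; inj₁; inj₂; [_,_]′)
open import Data.Vec.Base as Vec using (Vec; []; _∷_; _++_; here; there)
import Data.Vec.Properties as Vec
open import Function.Base using (_∘_; const)
open import Function.Bundles using (_⇔_; mk⇔; Equivalence)
open import Function.Definitions using (Injective)
open import Level using (Level)
open import Relation.Binary.Definitions using (tri<; tri≈; tri>)
open import Relation.Binary.PropositionalEquality.Core as ≡ using (_≡_; _≢_; cong; cong₂; subst; subst₂)
open import Relation.Binary.PropositionalEquality.Properties using (module ≡-Reasoning)
open import Relation.Binary.Structures using (IsStrictTotalOrder)
open import Relation.Nullary.Decidable.Core using (Dec; does; yes; no; _×-dec_; ¬?)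
open import Relation.Nullary.Negation.Core using (¬_; contradiction)
open import Relation.Unary using (Pred; Decidable)

-- Two obstacles shape the details. The term order for X′ is unrelated to the one for X, so a
-- restricted pair may need the opposite orientation, and an oriented divisor over X yields over X′
-- only a divisor up to swap. A descent on total degree recovers an oriented one. The other obstacle
-- is constructive: equality with 0 in the field is not decidable and polynomials are lists with
-- repeated monomials, so a nonzero term cannot be found by inspection. Terms are found through
-- linear functionals instead, sending a sum of terms a·m to the sum of a · ψ(m). A value apart from
-- 0 forces, by cotransitivity of apartness, some monomial with a coefficient apart from 0.
-- Functionals that depend only on the degree of a monomial annihilate the toric ideal, and this is
-- the source of the partner terms.

private variable
  ℓ ℓ′ : Level
  n s k r : ℕ
  P : Set ℓ

module _ where

  open import Algebra.Properties.CommutativeSemigroup ℕ.+-commutativeSemigroup using (interchange)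
  open import Data.Nat.Base using (_+_; _*_; _<_)
  open ≡ using (refl; sym; trans)

  -- Exponent vectors, divisibility and exchange.

  infix 4 _⊑_ _≟_

  _≟_ : (m m′ : Monomial n) → Dec (m ≡ m′)
  _≟_ = Vec.≡-dec ℕ._≟_

  ·-assoc : (a b c : Monomial n) → (a · b) · c ≡ a · (b · c)
  ·-assoc = Vec.zipWith-assoc ℕ.+-assoc

  ·-comm : (a b : Monomial n) → a · b ≡ b · a
  ·-comm = Vec.zipWith-comm ℕ.+-comm

  ·-interchange : (a b c d : Monomial n) → (a · b) · (c · d) ≡ (a · c) · (b · d)
  ·-interchange []      []      []      []      = refl
  ·-interchange (x ∷ a) (y ∷ b) (z ∷ c) (w ∷ d) = cong₂ _∷_ (interchange x y z w) (·-interchange a b c d)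

  ·-identityˡ : (a : Monomial n) → 𝟙 · a ≡ a
  ·-identityˡ = Vec.zipWith-identityˡ ℕ.+-identityˡ

  ·-identityʳ : (a : Monomial n) → a · 𝟙 ≡ a
  ·-identityʳ = Vec.zipWith-identityʳ ℕ.+-identityʳ

  ·-cancelˡ : (t : Monomial n) {a b : Monomial n} → t · a ≡ t · b → a ≡ b
  ·-cancelˡ []      {[]}    {[]}    eq = refl
  ·-cancelˡ (x ∷ t) {y ∷ a} {z ∷ b} eq =
    cong₂ _∷_ (ℕ.+-cancelˡ-≡ x y z (Vec.∷-injectiveˡ eq)) (·-cancelˡ t (Vec.∷-injectiveʳ eq))

  ·-identityˡ-unique : (t a : Monomial n) → t · a ≡ a → t ≡ 𝟙
  ·-identityˡ-unique t a eq = ·-cancelˡ a (trans (trans (·-comm a t) eq) (sym (·-identityʳ a)))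

  ·-++ : (a a′ : Monomial n) (b b′ : Monomial k) → (a ++ b) · (a′ ++ b′) ≡ (a · a′) ++ (b · b′)
  ·-++ a a′ b b′ = Vec.zipWith-++ _ a b a′ b′

  𝟙-++ : ∀ n {k} → 𝟙 {n} ++ 𝟙 {k} ≡ 𝟙
  𝟙-++ zero    = refl
  𝟙-++ (suc n) = cong (0 ∷_) (𝟙-++ n)

  monomial-induction : (P : Monomial n → Set ℓ) →
    P 𝟙 → (∀ h {m} → P m → P (unit h · m)) → ∀ m → P m
  monomial-induction P p𝟙 step []      = p𝟙
  monomial-induction P p𝟙 step (x ∷ m) = raise x
    where
    p0 : P (0 ∷ m)
    p0 = monomial-induction (P ∘ (0 ∷_)) p𝟙 (λ h → step (suc h)) m
    raise : ∀ x → P (x ∷ m)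
    raise zero    = p0
    raise (suc x) = subst (λ m′ → P (suc x ∷ m′)) (·-identityˡ m) (step zero (raise x))

  _⊑_ : Monomial n → Monomial n → Set
  m ⊑ m′ = ∃[ t ] t · m ≡ m′

  ⊑-trans : {a b c : Monomial n} → a ⊑ b → b ⊑ c → a ⊑ c
  ⊑-trans (t , refl) (t′ , refl) = t′ · t , ·-assoc t′ t _

  ++-split : ∀ n {k} (m : Monomial (n + k)) → ∃₂ λ a b → m ≡ a ++ b
  ++-split n m = Vec.splitAt n m

  ++-⊑ : {a a′ : Monomial n} {b b′ : Monomial k} → a ⊑ a′ → b ⊑ b′ → a ++ b ⊑ a′ ++ b′
  ++-⊑ (t , refl) (t′ , refl) = t ++ t′ , ·-++ t _ t′ _

  ++-⊑⁻ : {a a′ : Monomial n} {b b′ : Monomial k} → a ++ b ⊑ a′ ++ b′ → a ⊑ a′ × b ⊑ b′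
  ++-⊑⁻ {n} {a = a} {a′} {b} (t , eq) with t₁ , t₂ , refl ← ++-split n t =
    (t₁ , Vec.++-injectiveˡ _ a′ eq′) , (t₂ , Vec.++-injectiveʳ _ a′ eq′)
    where eq′ = trans (sym (·-++ t₁ a t₂ b)) eq

  -- Here `p` and `q` are the minima of `a , a′` and of `c , c′`, while `u` and `v` are the positive
  -- and negative parts of a - a′, which equals c′ - c.
  exchangeℕ : ∀ a a′ c c′ → a + c ≡ a′ + c′ →
    ∃[ p ] ∃[ q ] ∃[ u ] ∃[ v ] (p + u ≡ a × p + v ≡ a′ × q + v ≡ c × q + u ≡ c′)
  exchangeℕ zero    a′      c c′ eq =
    0 , c′ , 0 , a′ , refl , refl , trans (ℕ.+-comm c′ a′) (sym eq) , ℕ.+-identityʳ c′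
  exchangeℕ (suc a) zero    c c′ eq =
    0 , c , suc a , 0 , refl , refl , ℕ.+-identityʳ c , trans (ℕ.+-comm c (suc a)) eq
  exchangeℕ (suc a) (suc a′) c c′ eq with exchangeℕ a a′ c c′ (ℕ.suc-injective eq)
  ... | p , q , u , v , refl , refl , eq₁ , eq₂ = suc p , q , u , v , refl , refl , eq₁ , eq₂

  exchange : (a a′ c c′ : Monomial n) → a · c ≡ a′ · c′ →
    ∃[ p ] ∃[ q ] ∃[ u ] ∃[ v ] (p · u ≡ a × p · v ≡ a′ × q · v ≡ c × q · u ≡ c′)
  exchange [] [] [] [] eq = [] , [] , [] , [] , refl , refl , refl , refl
  exchange (a ∷ as) (a′ ∷ as′) (c ∷ cs) (c′ ∷ cs′) eq
    with exchangeℕ a a′ c c′ (Vec.∷-injectiveˡ eq) | exchange as as′ cs cs′ (Vec.∷-injectiveʳ eq)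
  ... | p , q , u , v , refl , refl , refl , refl | ps , qs , us , vs , refl , refl , refl , refl =
    p ∷ ps , q ∷ qs , u ∷ us , v ∷ vs , refl , refl , refl , refl

  -- Degrees with respect to a matrix and its Lawrence lifting.

  dot : Vec ℕ n → Monomial n → ℕ
  dot row m = Vec.sum (Vec.zipWith _*_ row m)

  dot-· : (row a b : Vec ℕ n) → dot row (a · b) ≡ dot row a + dot row b
  dot-· []        []      []      = refl
  dot-· (x ∷ row) (y ∷ a) (z ∷ b) = trans
    (cong₂ _+_ (ℕ.*-distribˡ-+ x y z) (dot-· row a b))
    (interchange (x * y) (x * z) (dot row a) (dot row b))

  dot-comm : (a b : Vec ℕ n) → dot a b ≡ dot b a
  dot-comm a b = cong Vec.sum (Vec.zipWith-comm ℕ.*-comm a b)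

  dot-𝟙 : (a : Vec ℕ n) → dot 𝟙 a ≡ 0
  dot-𝟙 []      = refl
  dot-𝟙 (x ∷ a) = dot-𝟙 a

  dot-unit : (h : Fin n) (a : Vec ℕ n) → dot (unit h) a ≡ Vec.lookup a h
  dot-unit zero    (x ∷ a) = trans (cong₂ _+_ (ℕ.*-identityˡ x) (dot-𝟙 a)) (ℕ.+-identityʳ x)
  dot-unit (suc h) (x ∷ a) = dot-unit h a

  dot-++ : (a a′ : Vec ℕ n) (b b′ : Vec ℕ k) → dot (a ++ b) (a′ ++ b′) ≡ dot a a′ + dot b b′
  dot-++ a a′ b b′ = trans (cong Vec.sum (Vec.zipWith-++ _*_ a b a′ b′)) (Vec.sum-++ (Vec.zipWith _*_ a a′))

  degree : Matrix s n → Monomial n → Vec ℕ s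
  degree A m = Vec.map (λ row → dot row m) A

  degree-· : (A : Matrix s n) (a b : Monomial n) → degree A (a · b) ≡ degree A a · degree A b
  degree-· []        a b = refl
  degree-· (row ∷ A) a b = cong₂ _∷_ (dot-· row a b) (degree-· A a b)

  degree-𝟙 : (A : Matrix s n) → degree A 𝟙 ≡ 𝟙
  degree-𝟙 []        = refl
  degree-𝟙 (row ∷ A) = cong₂ _∷_ (trans (dot-comm row 𝟙) (dot-𝟙 row)) (degree-𝟙 A)

  degree-unit : (A : Matrix s n) (h : Fin n) → degree A (unit h) ≡ column A h
  degree-unit A h = Vec.map-cong (λ row → trans (dot-comm row (unit h)) (dot-unit h row)) A

  degree-cancelˡ : (A : Matrix s n) (t : Monomial n) {t′ a b : Monomial n} →
    degree A t ≡ degree A t′ → degree A (t · a) ≡ degree A (t′ · b) → degree A a ≡ degree A b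
  degree-cancelˡ A t {t′} {a} {b} eq₁ eq₂ = ·-cancelˡ (degree A t) (begin
    degree A t · degree A a   ≡⟨ degree-· A t a ⟨
    degree A (t · a)          ≡⟨ eq₂ ⟩
    degree A (t′ · b)         ≡⟨ degree-· A t′ b ⟩
    degree A t′ · degree A b  ≡⟨ cong (_· degree A b) eq₁ ⟨
    degree A t · degree A b   ∎)
    where open ≡-Reasoning

  -- The two identity blocks record the product `a · b`; this extra invariant is what makes
  -- `exchange` applicable to monomials of equal Lawrence degree.
  degree-lawrence : (A : Matrix s k) (a b : Monomial k) →
    degree (lawrence A) (a ++ b) ≡ degree A a ++ (a · b)
  degree-lawrence {k = k} A a b = trans
    (Vec.map-++ _ (Vec.map (λ row → row ++ Vec.replicate k 0) A) _)
    (cong₂ _++_ left right)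
    where
    open ≡-Reasoning
    left = trans (sym (Vec.map-∘ _ _ A)) (Vec.map-cong (λ row → trans (dot-++ row a 𝟙 b)
      (trans (cong (dot row a +_) (dot-𝟙 b)) (ℕ.+-identityʳ _))) A)
    right : Vec.map (λ row → dot row (a ++ b)) (Vec.map (λ row → row ++ row) (identity k)) ≡ a · b
    right = begin
      _
        ≡⟨ Vec.map-∘ _ _ (identity k) ⟨
      Vec.map (λ row → dot (row ++ row) (a ++ b)) (identity k)
        ≡⟨ Vec.tabulate-∘ _ unit ⟨
      Vec.tabulate (λ h → dot (unit h ++ unit h) (a ++ b))
        ≡⟨ Vec.tabulate-cong (λ h → trans (dot-++ (unit h) a (unit h) b)
             (trans (cong₂ _+_ (dot-unit h a) (dot-unit h b)) (sym (Vec.lookup-zipWith _+_ h a b)))) ⟩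
      Vec.tabulate (Vec.lookup (a · b))
        ≡⟨ Vec.tabulate∘lookup (a · b) ⟩
      a · b
        ∎

  module _ (A : Matrix s n) where

    -- The grading of K[x , y] that puts x_h in degree `column A h` and y_ℓ in the ℓ-th unit degree;
    -- it makes every toric generator homogeneous.
    weight : Monomial (n + s) → Vec ℕ s
    weight m = degree A (Vec.take n m) · Vec.drop n m

    weight-++ : (a : Monomial n) (b : Monomial s) → weight (a ++ b) ≡ degree A a · b
    weight-++ a b = cong₂ (λ a b → degree A a · b)
      (Vec.++-injectiveˡ _ a (Vec.take++drop≡id n (a ++ b)))
      (Vec.++-injectiveʳ _ a (Vec.take++drop≡id n (a ++ b)))

    weight-· : (a b : Monomial (n + s)) → weight (a · b) ≡ weight a · weight b
    weight-· a b = subst₂ (λ a b → weight (a · b) ≡ weight a · weight b)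
      (Vec.take++drop≡id n a) (Vec.take++drop≡id n b)
      (split (Vec.take n a) (Vec.drop n a) (Vec.take n b) (Vec.drop n b))
      where
      split : ∀ a₁ a₂ b₁ b₂ → weight ((a₁ ++ a₂) · (b₁ ++ b₂)) ≡ weight (a₁ ++ a₂) · weight (b₁ ++ b₂)
      split a₁ a₂ b₁ b₂ = begin
        weight ((a₁ ++ a₂) · (b₁ ++ b₂))           ≡⟨ cong weight (·-++ a₁ b₁ a₂ b₂) ⟩
        weight ((a₁ · b₁) ++ (a₂ · b₂))            ≡⟨ weight-++ (a₁ · b₁) (a₂ · b₂) ⟩
        degree A (a₁ · b₁) · (a₂ · b₂)             ≡⟨ cong (_· (a₂ · b₂)) (degree-· A a₁ b₁) ⟩
        (degree A a₁ · degree A b₁) · (a₂ · b₂)    ≡⟨ ·-interchange (degree A a₁) (degree A b₁) a₂ b₂ ⟩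
        (degree A a₁ · a₂) · (degree A b₁ · b₂)    ≡⟨ cong₂ _·_ (weight-++ a₁ a₂) (weight-++ b₁ b₂) ⟨
        weight (a₁ ++ a₂) · weight (b₁ ++ b₂)      ∎
        where open ≡-Reasoning

  -- Restriction to a subset of the cells.

  dot-restrict : (p : Subset k) (row : Vec ℕ k) (w : Monomial ∣ p ∣) →
    dot (restrict p row) w ≡ dot row (extend p w)
  dot-restrict []            []        []      = refl
  dot-restrict (inside  ∷ p) (x ∷ row) (y ∷ w) = cong (x * y +_) (dot-restrict p row w)
  dot-restrict (outside ∷ p) (x ∷ row) w       = trans (dot-restrict p row w)
    (cong (_+ dot row (extend p w)) (sym (ℕ.*-zeroʳ x)))

  degree-submatrix : (p : Subset k) (A : Matrix s k) (w : Monomial ∣ p ∣) →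
    degree (submatrix p A) w ≡ degree A (extend p w)
  degree-submatrix p A w = trans (sym (Vec.map-∘ _ _ A)) (Vec.map-cong (λ row → dot-restrict p row w) A)

  restrict-extend : (p : Subset k) (w : Monomial ∣ p ∣) → restrict p (extend p w) ≡ w
  restrict-extend []            []      = refl
  restrict-extend (inside  ∷ p) (x ∷ w) = cong (x ∷_) (restrict-extend p w)
  restrict-extend (outside ∷ p) w       = restrict-extend p w

  extend-injective : (p : Subset k) {w w′ : Monomial ∣ p ∣} → extend p w ≡ extend p w′ → w ≡ w′
  extend-injective p {w} {w′} eq =
    trans (sym (restrict-extend p w)) (trans (cong (restrict p) eq) (restrict-extend p w′))

  restrict-· : (p : Subset k) (a b : Monomial k) → restrict p (a · b) ≡ restrict p a · restrict p b
  restrict-· []            []      []      = refl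
  restrict-· (inside  ∷ p) (x ∷ a) (y ∷ b) = cong (x + y ∷_) (restrict-· p a b)
  restrict-· (outside ∷ p) (x ∷ a) (y ∷ b) = restrict-· p a b

  extend-· : (p : Subset k) (a b : Monomial ∣ p ∣) → extend p (a · b) ≡ extend p a · extend p b
  extend-· []            []      []      = refl
  extend-· (inside  ∷ p) (x ∷ a) (y ∷ b) = cong (x + y ∷_) (extend-· p a b)
  extend-· (outside ∷ p) a       b       = cong (0 ∷_) (extend-· p a b)

  extend-⊑ : (p : Subset k) {a b : Monomial ∣ p ∣} → a ⊑ b → extend p a ⊑ extend p b
  extend-⊑ p (t , eq) = extend p t , trans (sym (extend-· p t _)) (cong (extend p) eq)

  -- As an equation between vectors this is decidable, and it lets a supported monomial be rewritten
  -- as an extension.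
  SupportedIn : Subset k → Monomial k → Set
  SupportedIn p m = extend p (restrict p m) ≡ m

  ⊑-extend⇒supported : (p : Subset k) (m : Monomial k) {w : Monomial ∣ p ∣} →
    m ⊑ extend p w → SupportedIn p m
  ⊑-extend⇒supported []            []          _        = refl
  ⊑-extend⇒supported (inside  ∷ p) (x ∷ m) {y ∷ w} (z ∷ t , eq) =
    cong (x ∷_) (⊑-extend⇒supported p m (t , Vec.∷-injectiveʳ eq))
  ⊑-extend⇒supported (outside ∷ p) (x ∷ m) (z ∷ t , eq) = cong₂ _∷_
    (sym (ℕ.m+n≡0⇒n≡0 z (Vec.∷-injectiveˡ eq)))
    (⊑-extend⇒supported p m (t , Vec.∷-injectiveʳ eq))

  ⊑-extend⇒restrict-⊑ : (p : Subset k) {m : Monomial k} {w : Monomial ∣ p ∣} →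
    m ⊑ extend p w → restrict p m ⊑ w
  ⊑-extend⇒restrict-⊑ p {m} {w} (t , eq) =
    restrict p t , trans (sym (restrict-· p t m)) (trans (cong (restrict p) eq) (restrict-extend p w))

  unsupported : (q : Subset k) (m : Monomial k) → ¬ SupportedIn (∁ q) m →
    ∃[ h ] h ∈ q × 0 < Vec.lookup m h
  unsupported []            []          ¬s = contradiction refl ¬s
  unsupported (inside  ∷ q) (suc x ∷ m) ¬s = zero , here , s≤s z≤n
  unsupported (inside  ∷ q) (zero ∷ m)  ¬s with unsupported q m (¬s ∘ cong (0 ∷_))
  ... | h , h∈ , pos = suc h , there h∈ , pos
  unsupported (outside ∷ q) (x ∷ m)     ¬s with unsupported q m (¬s ∘ cong (x ∷_))
  ... | h , h∈ , pos = suc h , there h∈ , pos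

  lookup-extend-∁ : (q : Subset k) (w : Monomial ∣ ∁ q ∣) {h : Fin k} →
    h ∈ q → Vec.lookup (extend (∁ q) w) h ≡ 0
  lookup-extend-∁ (inside  ∷ q) w       here       = refl
  lookup-extend-∁ (inside  ∷ q) w       (there h∈) = lookup-extend-∁ q w h∈
  lookup-extend-∁ (outside ∷ q) (x ∷ w) (there h∈) = lookup-extend-∁ q w h∈

  -- Term orders, Graver families and the orientation of pairs.

  module TermOrderProperties (order : TermOrder n ℓ) where
    open TermOrder order public
    open IsStrictTotalOrder isStrictTotalOrder public
      using (compare; irrefl; asym) renaming (trans to ≺-trans)

    ≢⇒≺⊎≻ : ∀ {m m′} → m ≢ m′ → m ≺ m′ ⊎ m′ ≺ m
    ≢⇒≺⊎≻ {m} {m′} m≢m′ with compare m m′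
    ... | tri< m≺m′ _ _ = inj₁ m≺m′
    ... | tri≈ _ eq _   = contradiction eq m≢m′
    ... | tri> _ _ m′≺m = inj₂ m′≺m

    ·-cancelˡ-≺ : ∀ t {m m′} → t · m ≺ t · m′ → m ≺ m′
    ·-cancelˡ-≺ t {m} {m′} lt with compare m m′
    ... | tri< m≺m′ _ _ = m≺m′
    ... | tri≈ _ refl _ = contradiction lt (irrefl refl)
    ... | tri> _ _ m′≺m = contradiction lt (asym (·-monoʳ-≺ t m′≺m))

    ⊑⇒≡⊎≺ : ∀ {m m′} → m ⊑ m′ → m ≡ m′ ⊎ m ≺ m′
    ⊑⇒≡⊎≺ {m} (t , refl) with t ≟ 𝟙
    ... | yes refl = inj₁ (sym (·-identityˡ m))
    ... | no t≢𝟙   = inj₂ (subst₂ _≺_ (·-identityʳ m) (·-comm m t) (·-monoʳ-≺ m (𝟙-least t≢𝟙)))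

    ⊑-antisym : ∀ {m m′} → m ⊑ m′ → m′ ⊑ m → m ≡ m′
    ⊑-antisym m⊑m′ m′⊑m with ⊑⇒≡⊎≺ m⊑m′ | ⊑⇒≡⊎≺ m′⊑m
    ... | inj₁ eq | _        = eq
    ... | inj₂ _  | inj₁ eq  = sym eq
    ... | inj₂ lt | inj₂ lt′ = contradiction lt (asym lt′)

  -- The differences u - v form the Graver basis of `A`, with one sign of each chosen by the order.
  -- `divisor` is the Gröbner property. `separated` and `separated-swap` are reducedness for the
  -- larger and the smaller monomial of each Lawrence binomial.
  record IsGraverFamily (A : Matrix s k) (order : TermOrder (k + k) ℓ)
                        (u v : Fin r → Monomial k) : Set ℓ where
    open TermOrder order using (_≺_)
    field
      balanced  : ∀ i → degree A (u i) ≡ degree A (v i)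
      oriented  : ∀ i → v i ++ u i ≺ u i ++ v i
      divisor   : ∀ {a b} → degree A a ≡ degree A b → b ++ a ≺ a ++ b → ∃[ i ] u i ⊑ a × v i ⊑ b
      separated : ∀ {i j} → j ≢ i → ¬ (u j ⊑ u i × v j ⊑ v i)
      separated-swap : ∀ {i j} → j ≢ i → ¬ (u j ⊑ v i × v j ⊑ u i)

  enumerate : ∀ r {P : Pred (Fin r) ℓ} → Decidable P →
    ∃[ r′ ] ∃ λ (ι : Fin r′ → Fin r) →
      Injective _≡_ _≡_ ι × (∀ i′ → P (ι i′)) × (∀ i → P i → ∃[ i′ ] ι i′ ≡ i)
  enumerate zero    P? = 0 , (λ ()) , (λ { {()} }) , (λ ()) , (λ ())
  enumerate (suc r) P? with enumerate r (P? ∘ suc) | P? zero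
  ... | r′ , ι , inj , sound , complete | no ¬p0 =
    r′ , suc ∘ ι , inj ∘ Fin.suc-injective , sound ,
    λ { zero p → contradiction p ¬p0
      ; (suc i) p → let i′ , eq = complete i p in i′ , cong suc eq }
  ... | r′ , ι , inj , sound , complete | yes p0 =
    suc r′ ,
    (λ { zero → zero ; (suc i′) → suc (ι i′) }) ,
    (λ { {zero} {zero} _ → refl ; {suc _} {suc _} eq → cong suc (inj (Fin.suc-injective eq)) }) ,
    (λ { zero → p0 ; (suc i′) → sound i′ }) ,
    λ { zero p → zero , refl
      ; (suc i) p → let i′ , eq = complete i p in suc i′ , cong suc eq }

  ≡⊎swap : (a b c d : Monomial k) → Set
  ≡⊎swap a b c d = (a ≡ c × b ≡ d) ⊎ (a ≡ d × b ≡ c)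

  ≡⊎swap-sym : {a b c d : Monomial k} → ≡⊎swap a b c d → ≡⊎swap c d a b
  ≡⊎swap-sym (inj₁ (refl , refl)) = inj₁ (refl , refl)
  ≡⊎swap-sym (inj₂ (refl , refl)) = inj₂ (refl , refl)

  module SwapProperties (order : TermOrder (k + k) ℓ) where
    open TermOrderProperties order

    ≺-swap⇒≢ : {a b : Monomial k} → b ++ a ≺ a ++ b → a ≢ b
    ≺-swap⇒≢ lt refl = irrefl refl lt

    orient : {a b : Monomial k} → a ≢ b → ∃₂ λ c d → ≡⊎swap a b c d × d ++ c ≺ c ++ d
    orient {a} {b} a≢b with compare (b ++ a) (a ++ b)
    ... | tri< lt _ _ = a , b , inj₁ (refl , refl) , lt
    ... | tri≈ _ eq _ = contradiction (sym (Vec.++-injectiveˡ b a eq)) a≢b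
    ... | tri> _ _ gt = b , a , inj₂ (refl , refl) , gt

    -- Orientation is multiplicative: the positive pair (s · b , t · a) is the product of (s , t)
    -- with the negative pair (b , a). If (s , t) were trivial or negative, the product would be
    -- negative too.
    ≺-swap-quotient : {s t a b : Monomial k} → b ++ a ≺ a ++ b →
      (t · a) ++ (s · b) ≺ (s · b) ++ (t · a) → t ++ s ≺ s ++ t
    ≺-swap-quotient {s} {t} {a} {b} lt lt′ with compare (t ++ s) (s ++ t)
    ... | tri< t++s≺s++t _ _ = t++s≺s++t
    ... | tri≈ _ eq _ with refl ← Vec.++-injectiveˡ t s eq = contradiction lt″ (asym lt′)
      where
      lt″ : (t · b) ++ (t · a) ≺ (t · a) ++ (t · b)
      lt″ = subst₂ _≺_ (·-++ t b t a) (·-++ t a t b) (·-monoʳ-≺ (t ++ t) lt)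
    ... | tri> _ _ s++t≺t++s = contradiction (≺-trans step₁ step₂) (asym lt′)
      where
      step₁ : (s · b) ++ (t · a) ≺ (t · b) ++ (s · a)
      step₁ = subst₂ _≺_
        (trans (·-comm (b ++ a) (s ++ t)) (·-++ s b t a))
        (trans (·-comm (b ++ a) (t ++ s)) (·-++ t b s a))
        (·-monoʳ-≺ (b ++ a) s++t≺t++s)
      step₂ : (t · b) ++ (s · a) ≺ (t · a) ++ (s · b)
      step₂ = subst₂ _≺_ (·-++ t b s a) (·-++ t a s b) (·-monoʳ-≺ (t ++ s) lt)

  sum-· : (a b : Monomial n) → Vec.sum (a · b) ≡ Vec.sum a + Vec.sum b
  sum-· []      []      = refl
  sum-· (x ∷ a) (y ∷ b) = trans (cong (x + y +_) (sum-· a b)) (interchange x y _ _)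

  sum≡0⇒𝟙 : (a : Monomial n) → Vec.sum a ≡ 0 → a ≡ 𝟙
  sum≡0⇒𝟙 []         eq = refl
  sum≡0⇒𝟙 (zero ∷ a) eq = cong (0 ∷_) (sum≡0⇒𝟙 a eq)

  -- As `a ≢ b`, at least one of them is not `𝟙`, so passing to the cofactors lowers the total
  -- degree. This is the measure of the descent in `divisor′-bounded`.
  size-decreases : (s t : Monomial k) {a b : Monomial k} → a ≢ b →
    Vec.sum s + Vec.sum t < Vec.sum (s · b) + Vec.sum (t · a)
  size-decreases s t {a} {b} a≢b = begin-strict
    Vec.sum s + Vec.sum t                               <⟨ ℕ.m<m+n _ positive ⟩
    (Vec.sum s + Vec.sum t) + (Vec.sum b + Vec.sum a)   ≡⟨ interchange (Vec.sum s) (Vec.sum t) (Vec.sum b) (Vec.sum a) ⟩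
    (Vec.sum s + Vec.sum b) + (Vec.sum t + Vec.sum a)   ≡⟨ cong₂ _+_ (sum-· s b) (sum-· t a) ⟨
    Vec.sum (s · b) + Vec.sum (t · a)                   ∎
    where
    open ℕ.≤-Reasoning
    positive : 0 < Vec.sum b + Vec.sum a
    positive = ℕ.n≢0⇒n>0 λ eq → a≢b (trans
      (sum≡0⇒𝟙 a (ℕ.m+n≡0⇒n≡0 (Vec.sum b) eq)) (sym (sum≡0⇒𝟙 b (ℕ.m+n≡0⇒m≡0 _ eq))))

  -- Graver families under restriction, and exchange in the Lawrence ideal.

  Supported : Subset k → (u v : Fin r → Monomial k) → Fin r → Set
  Supported p u v i = SupportedIn p (u i) × SupportedIn p (v i)

  -- `restricts` holds only up to swap because `order′` may orient a surviving pair differently from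
  -- the order on X.
  record IsRestriction (p : Subset k) (order′ : TermOrder (∣ p ∣ + ∣ p ∣) ℓ) (u v : Fin r → Monomial k)
                       (ι : Fin n → Fin r) (u′ v′ : Fin n → Monomial ∣ p ∣) : Set ℓ where
    open TermOrder order′ using (_≺_)
    field
      injective : Injective _≡_ _≡_ ι
      supported : ∀ i′ → Supported p u v (ι i′)
      complete  : ∀ i → Supported p u v i → ∃[ i′ ] ι i′ ≡ i
      restricts : ∀ i′ → ≡⊎swap (restrict p (u (ι i′))) (restrict p (v (ι i′))) (u′ i′) (v′ i′)
      oriented  : ∀ i′ → v′ i′ ++ u′ i′ ≺ u′ i′ ++ v′ i′

    extends : ∀ i′ → ≡⊎swap (u (ι i′)) (v (ι i′)) (extend p (u′ i′)) (extend p (v′ i′))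
    extends i′ with su , sv ← supported i′ = Sum.map
      (λ { (eq₁ , eq₂) → trans (sym su) (cong (extend p) eq₁) , trans (sym sv) (cong (extend p) eq₂) })
      (λ { (eq₁ , eq₂) → trans (sym su) (cong (extend p) eq₁) , trans (sym sv) (cong (extend p) eq₂) })
      (restricts i′)

  restriction-exists : {A : Matrix s k} {order : TermOrder (k + k) ℓ} {u v : Fin r → Monomial k} →
    IsGraverFamily A order u v → (p : Subset k) (order′ : TermOrder (∣ p ∣ + ∣ p ∣) ℓ′) →
    ∃[ r′ ] ∃ λ (ι : Fin r′ → Fin r) → ∃₂ (IsRestriction p order′ u v ι)
  restriction-exists {k = k} {r = r} {order = order} {u} {v} graver p order′
    with r′ , ι , injective , supported , complete ← enumerate r {Supported p u v} (λ i → (_ ≟ u i) ×-dec (_ ≟ v i))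
    = r′ , ι , (λ i′ → proj₁ (oriented i′)) , (λ i′ → proj₁ (proj₂ (oriented i′))) , record
      { injective = injective
      ; supported = supported
      ; complete  = complete
      ; restricts = λ i′ → proj₁ (proj₂ (proj₂ (oriented i′)))
      ; oriented  = λ i′ → proj₂ (proj₂ (proj₂ (oriented i′)))
      }
    where
    restrict-≢ : ∀ {i} → Supported p u v i → restrict p (u i) ≢ restrict p (v i)
    restrict-≢ {i} (su , sv) eq =
      SwapProperties.≺-swap⇒≢ {k = k} order (IsGraverFamily.oriented graver i)
        (trans (sym su) (trans (cong (extend p) eq) sv))
    oriented = λ i′ → SwapProperties.orient {k = ∣ p ∣} order′ (restrict-≢ (supported i′))

  module _
    {A : Matrix s k} {order : TermOrder (k + k) ℓ} {u v : Fin r → Monomial k}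
    (graver : IsGraverFamily A order u v)
    {p : Subset k} {order′ : TermOrder (∣ p ∣ + ∣ p ∣) ℓ′}
    {ι : Fin n → Fin r} {u′ v′ : Fin n → Monomial ∣ p ∣}
    (restriction : IsRestriction p order′ u v ι u′ v′) where

    private
      open IsGraverFamily graver
      open IsRestriction restriction using (extends; restricts) renaming
        (injective to ι-injective; complete to ι-complete; oriented to oriented′)
      open SwapProperties {k = k} order
      open SwapProperties {k = ∣ p ∣} order′ using () renaming
        ( ≺-swap⇒≢ to ≺′-swap⇒≢; ≺-swap-quotient to ≺′-swap-quotient)
      open TermOrder order′ using () renaming (_≺_ to _≺′_)

      A′ = submatrix p A

      balanced′ : ∀ i′ → degree A′ (u′ i′) ≡ degree A′ (v′ i′)
      balanced′ i′ = trans (degree-submatrix p A (u′ i′)) (trans eq (sym (degree-submatrix p A (v′ i′))))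
        where
        eq : degree A (extend p (u′ i′)) ≡ degree A (extend p (v′ i′))
        eq with extends i′
        ... | inj₁ (eq₁ , eq₂) = trans (cong (degree A) (sym eq₁)) (trans (balanced (ι i′)) (cong (degree A) eq₂))
        ... | inj₂ (eq₁ , eq₂) = trans (cong (degree A) (sym eq₂)) (trans (sym (balanced (ι i′))) (cong (degree A) eq₁))

      -- Swapping either pair exchanges the conditions `separated` and `separated-swap` or keeps
      -- both, so together they are insensitive to reorientation.
      separated-up-to-swap : ∀ {i j a b c d} → j ≢ i →
        ≡⊎swap (u i) (v i) a b → ≡⊎swap (u j) (v j) c d → ¬ (c ⊑ a × d ⊑ b)
      separated-up-to-swap j≢i (inj₁ (refl , refl)) (inj₁ (refl , refl)) d = separated j≢i d
      separated-up-to-swap j≢i (inj₂ (refl , refl)) (inj₁ (refl , refl)) d = separated-swap j≢i d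
      separated-up-to-swap j≢i (inj₁ (refl , refl)) (inj₂ (refl , refl)) d = separated-swap j≢i (swap d)
      separated-up-to-swap j≢i (inj₂ (refl , refl)) (inj₂ (refl , refl)) d = separated j≢i (swap d)

      extend-balanced : ∀ {a b} → degree A′ a ≡ degree A′ b → degree A (extend p a) ≡ degree A (extend p b)
      extend-balanced {a} {b} eq = trans (sym (degree-submatrix p A a)) (trans eq (degree-submatrix p A b))

      -- The divisor is found over X, after orienting the extension of (a , b) there. Since `order′`
      -- may reverse both this orientation and that of the divisor, the divisor is obtained only up
      -- to swap.
      divisor-up-to-swap : ∀ {a b} → degree A′ a ≡ degree A′ b → a ≢ b →
        ∃[ i′ ] (u′ i′ ⊑ a × v′ i′ ⊑ b ⊎ v′ i′ ⊑ a × u′ i′ ⊑ b)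
      divisor-up-to-swap {a} {b} eq a≢b with orient (a≢b ∘ extend-injective p)
      ... | c , d , inj₁ (refl , refl) , lt
        with i , div₁ , div₂ ← divisor (extend-balanced eq) lt
        with i′ , refl ← ι-complete i (⊑-extend⇒supported p _ div₁ , ⊑-extend⇒supported p _ div₂)
        with div₁′ ← ⊑-extend⇒restrict-⊑ p div₁ | div₂′ ← ⊑-extend⇒restrict-⊑ p div₂
        with restricts i′
      ... | inj₁ (eq₁ , eq₂) = i′ , inj₁ (subst (_⊑ a) eq₁ div₁′ , subst (_⊑ b) eq₂ div₂′)
      ... | inj₂ (eq₁ , eq₂) = i′ , inj₂ (subst (_⊑ a) eq₁ div₁′ , subst (_⊑ b) eq₂ div₂′)
      divisor-up-to-swap {a} {b} eq a≢b | c , d , inj₂ (refl , refl) , lt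
        with i , div₁ , div₂ ← divisor (extend-balanced (sym eq)) lt
        with i′ , refl ← ι-complete i (⊑-extend⇒supported p _ div₁ , ⊑-extend⇒supported p _ div₂)
        with div₁′ ← ⊑-extend⇒restrict-⊑ p div₁ | div₂′ ← ⊑-extend⇒restrict-⊑ p div₂
        with restricts i′
      ... | inj₁ (eq₁ , eq₂) = i′ , inj₂ (subst (_⊑ a) eq₂ div₂′ , subst (_⊑ b) eq₁ div₁′)
      ... | inj₂ (eq₁ , eq₂) = i′ , inj₁ (subst (_⊑ a) eq₂ div₂′ , subst (_⊑ b) eq₁ div₁′)

      -- If only the swapped pair divides (a , b), the cofactor is a smaller pair
      -- oriented as (a , b).
      divisor′-bounded : ∀ N {a b} → Vec.sum a + Vec.sum b < N →
        degree A′ a ≡ degree A′ b → b ++ a ≺′ a ++ b → ∃[ i′ ] u′ i′ ⊑ a × v′ i′ ⊑ b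
      divisor′-bounded (suc N) {a} {b} (s≤s size≤N) eq lt with divisor-up-to-swap eq (≺′-swap⇒≢ lt)
      ... | i′ , inj₁ div = i′ , div
      ... | i′ , inj₂ ((t₁ , refl) , (t₂ , refl))
        with j′ , div₁ , div₂ ← divisor′-bounded N {t₁} {t₂}
          (ℕ.<-≤-trans (size-decreases t₁ t₂ (≺′-swap⇒≢ (oriented′ i′))) size≤N)
          (degree-cancelˡ A′ (v′ i′) (sym (balanced′ i′))
            (trans (cong (degree A′) (·-comm (v′ i′) t₁)) (trans eq (cong (degree A′) (·-comm t₂ (u′ i′))))))
          (≺′-swap-quotient {t₁} {t₂} {u′ i′} {v′ i′} (oriented′ i′) lt)
        = j′ , ⊑-trans div₁ (v′ i′ , ·-comm (v′ i′) t₁) , ⊑-trans div₂ (u′ i′ , ·-comm (u′ i′) t₂)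

    restriction-isGraverFamily : IsGraverFamily A′ order′ u′ v′
    restriction-isGraverFamily = record
      { balanced       = balanced′
      ; oriented       = oriented′
      ; divisor        = divisor′-bounded _ ℕ.≤-refl
      ; separated      = λ j≢i d → separated-up-to-swap (j≢i ∘ ι-injective)
          (extends _) (extends _) (Product.map (extend-⊑ p) (extend-⊑ p) d)
      ; separated-swap = λ j≢i d → separated-up-to-swap (j≢i ∘ ι-injective)
          (Sum.swap (extends _)) (extends _) (Product.map (extend-⊑ p) (extend-⊑ p) d)
      }

  -- Since a · c ≡ a′ · c′, the difference of the two monomials has the shape
  -- (u , v) − (v , u).
  lawrence-exchange : (A : Matrix s k) (order : TermOrder (k + k) ℓ) → let open TermOrder order using (_≺_) in
    ∀ {m m′} → degree (lawrence A) m′ ≡ degree (lawrence A) m → m′ ≺ m →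
    ∃[ t ] ∃[ u ] ∃[ v ] (degree A u ≡ degree A v × v ++ u ≺ u ++ v × t · (u ++ v) ≡ m × t · (v ++ u) ≡ m′)
  lawrence-exchange {k = k} A order {m} {m′} eq m′≺m
    with a , c , refl ← ++-split k m | a′ , c′ , refl ← ++-split k m′
    with eq′ ← trans (sym (degree-lawrence A a′ c′)) (trans eq (degree-lawrence A a c))
    with exchange a a′ c c′ (sym (Vec.++-injectiveʳ _ (degree A a) eq′))
  ... | p , q , u , v , refl , refl , refl , refl =
    p ++ q , u , v ,
    degree-cancelˡ A p refl (sym (Vec.++-injectiveˡ _ (degree A (p · u)) eq′)) ,
    TermOrderProperties.·-cancelˡ-≺ order (p ++ q)
      (subst₂ (TermOrder._≺_ order) (sym (·-++ p v q u)) (sym (·-++ p u q v)) m′≺m) ,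
    ·-++ p u q v , ·-++ p v q u

  degree-lawrence-swap : (A : Matrix s k) {a b : Monomial k} → degree A a ≡ degree A b →
    degree (lawrence A) (a ++ b) ≡ degree (lawrence A) (b ++ a)
  degree-lawrence-swap A {a} {b} eq =
    trans (degree-lawrence A a b) (trans (cong₂ _++_ eq (·-comm a b)) (sym (degree-lawrence A b a)))

module _ {c ℓ₁ ℓ₂} (K : HeytingField c ℓ₁ ℓ₂) where

  open HeytingField K
  open CommutativeRing (HeytingCommutativeRing.commutativeRing heytingCommutativeRing)
    using (ring; +-group; +-commutativeSemigroup)
  open Polynomials K renaming
    (_≈_ to _≈ₚ_; _+_ to _+ₚ_; _*_ to _*ₚ_; -_ to -ₚ_; zero to zeroₚ)
  open import Algebra.Apartness.Properties.HeytingCommutativeRing heytingCommutativeRing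
    using (invertibleʳ⇒#; x-0≈x; 1#0; #-congʳ)
  open import Algebra.Properties.CommutativeSemigroup +-commutativeSemigroup
    using (interchange; x∙yz≈y∙xz)
  open import Algebra.Properties.Group +-group using
    (inverseʳ-unique; x∙y⁻¹≈ε⇒x≈y; x≈y⇒x∙y⁻¹≈ε; ⁻¹-anti-homo-//; //-rightDividesˡ; //-rightDividesʳ)
  open import Algebra.Properties.Ring ring using
    (-‿distribˡ-*; -1*x≈-x; -0#≈0#; -‿involutive; -‿+-comm)
  open import Relation.Binary.Reasoning.Setoid setoid

  -- Apartness from 0 in a Heyting field.

  unit⇒#0 : ∀ {x} y → x * y ≈ 1# → x # 0#
  unit⇒#0 {x} y eq = invertibleʳ⇒# (y , trans (*-congʳ (x-0≈x x)) eq)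

  #0⇒unit : ∀ {x} → x # 0# → ∃[ y ] x * y ≈ 1#
  #0⇒unit {x} x#0 with y , _ , eq ← #⇒invertible x#0 = y , trans (*-congʳ (sym (x-0≈x x))) eq

  *-#0 : ∀ {x y} → x * y # 0# → x # 0# × y # 0#
  *-#0 {x} {y} xy#0 with z , eq ← #0⇒unit xy#0 =
    unit⇒#0 (y * z) (trans (sym (*-assoc x y z)) eq) ,
    unit⇒#0 (x * z) (trans (sym (*-assoc y x z)) (trans (*-congʳ (*-comm y x)) eq))

  -- Cotransitivity, applied at `y`, makes the choice: either y # 0, or x + y # y and then the
  -- difference x is invertible. It replaces the test of a summand against 0.
  +-#0 : ∀ {x y} → x + y # 0# → x # 0# ⊎ y # 0#
  +-#0 {x} {y} x+y#0 with #-cotrans x+y#0 y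
  ... | inj₂ y#0   = inj₂ y#0
  ... | inj₁ x+y#y with z , _ , eq ← #⇒invertible x+y#y =
    inj₁ (unit⇒#0 z (trans (*-congʳ (sym (//-rightDividesʳ y x))) eq))

  -‿#0 : ∀ {x} → x # 0# → - x # 0#
  -‿#0 {x} x#0 = proj₂ (*-#0 {x = (- 1#)} (#-congʳ (sym (trans (-1*x≈-x (- x)) (-‿involutive x))) x#0))

  ≈⇒¬# : ∀ {x y} → x ≈ y → ¬ x # y
  ≈⇒¬# = proj₂ (tight _ _)

  ¬#0⇒≈0 : ∀ {x} → ¬ x # 0# → x ≈ 0#
  ¬#0⇒≈0 = proj₁ (tight _ _)

  -- Polynomials under linear functionals.

  [_]₁ : Dec P → Carrier
  [ P? ]₁ = if does P? then 1# else 0#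

  []₁-true : (P? : Dec P) → P → [ P? ]₁ ≈ 1#
  []₁-true (yes _) _ = refl
  []₁-true (no ¬p) p = contradiction p ¬p

  []₁-false : (P? : Dec P) → ¬ P → [ P? ]₁ ≈ 0#
  []₁-false (yes p) ¬p = contradiction p ¬p
  []₁-false (no _)  _  = refl

  []₁-#0 : (P? : Dec P) → [ P? ]₁ # 0# → P
  []₁-#0 (yes p) _   = p
  []₁-#0 (no _)  0#0 = contradiction 0#0 (≈⇒¬# refl)

  *-[]₁ : (P? : Dec P) (x : Carrier) → x * [ P? ]₁ ≈ (if does P? then x else 0#)
  *-[]₁ (yes _) x = *-identityʳ x
  *-[]₁ (no _)  x = zeroʳ x

  -- The value on `f` of the linear functional given by ψ on monomials. Coefficients, sums over one
  -- degree and evaluation at (1,...,1) are all of this form.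
  ∫ : (Monomial n → Carrier) → Polynomial n → Carrier
  ∫ ψ []            = 0#
  ∫ ψ ((a , m) ∷ f) = a * ψ m + ∫ ψ f

  coeff-∫ : (f : Polynomial n) (m : Monomial n) → coeff f m ≈ ∫ (λ m′ → [ m′ ≟ m ]₁) f
  coeff-∫ []             m = refl
  coeff-∫ ((a , m′) ∷ f) m = +-cong (sym (*-[]₁ (m′ ≟ m) a)) (coeff-∫ f m)

  ∫-cong : {ψ ψ′ : Monomial n → Carrier} → (∀ m → ψ m ≈ ψ′ m) → ∀ f → ∫ ψ f ≈ ∫ ψ′ f
  ∫-cong eq []            = refl
  ∫-cong eq ((a , m) ∷ f) = +-cong (*-congˡ (eq m)) (∫-cong eq f)

  ∫-+ : (ψ : Monomial n → Carrier) (f g : Polynomial n) → ∫ ψ (f +ₚ g) ≈ ∫ ψ f + ∫ ψ g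
  ∫-+ ψ []            g = sym (+-identityˡ _)
  ∫-+ ψ ((a , m) ∷ f) g = trans (+-congˡ (∫-+ ψ f g)) (sym (+-assoc _ _ _))

  ∫-neg : (ψ : Monomial n → Carrier) (f : Polynomial n) → ∫ ψ (-ₚ f) ≈ - ∫ ψ f
  ∫-neg ψ []            = sym -0#≈0#
  ∫-neg ψ ((a , m) ∷ f) = trans (+-cong (sym (-‿distribˡ-* a (ψ m))) (∫-neg ψ f)) (-‿+-comm _ _)

  ∫-map : (φ : Monomial n → Monomial k) (ψ : Monomial k → Carrier) (f : Polynomial n) →
    ∫ ψ (mapMonomials φ f) ≡ ∫ (ψ ∘ φ) f
  ∫-map φ ψ []            = ≡.refl
  ∫-map φ ψ ((a , m) ∷ f) = cong (a * ψ (φ m) +_) (∫-map φ ψ f)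

  ∫-+ψ : (ψ ψ′ : Monomial n → Carrier) (f : Polynomial n) → ∫ (λ m → ψ m + ψ′ m) f ≈ ∫ ψ f + ∫ ψ′ f
  ∫-+ψ ψ ψ′ []            = sym (+-identityˡ _)
  ∫-+ψ ψ ψ′ ((a , m) ∷ f) =
    trans (+-cong (distribˡ a (ψ m) (ψ′ m)) (∫-+ψ ψ ψ′ f)) (interchange _ _ _ _)

  ∫-term* : (ψ : Monomial n → Carrier) (a : Carrier) (t : Monomial n) (f : Polynomial n) →
    ∫ ψ (List.map (λ (b , m) → (a * b , t · m)) f) ≈ a * ∫ (ψ ∘ (t ·_)) f
  ∫-term* ψ a t []            = sym (zeroʳ a)
  ∫-term* ψ a t ((b , m) ∷ f) =
    trans (+-cong (*-assoc a b _) (∫-term* ψ a t f)) (sym (distribˡ a _ _))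

  ∫-∷* : (ψ : Monomial n → Carrier) (a : Carrier) (t : Monomial n) (g f : Polynomial n) →
    ∫ ψ (((a , t) ∷ g) *ₚ f) ≈ a * ∫ (ψ ∘ (t ·_)) f + ∫ ψ (g *ₚ f)
  ∫-∷* ψ a t g f = trans (∫-+ ψ (List.map (λ (b , m) → (a * b , t · m)) f) (g *ₚ f)) (+-congʳ (∫-term* ψ a t f))

  module _ (m : Monomial n) where
    private
      other? : Decidable (λ (t : Carrier × Monomial n) → proj₂ t ≢ m)
      other? (_ , m′) = ¬? (m′ ≟ m)

    without : Polynomial n → Polynomial n
    without = List.filter other?

    length-without-∷ : ∀ {a} f → List.length (without ((a , m) ∷ f)) ℕ.≤ List.length f
    length-without-∷ f with m ≟ m
    ... | yes _  = List.length-filter other? f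
    ... | no m≢m = contradiction ≡.refl m≢m

    ∫-without : ∀ ψ f → ∫ ψ f ≈ coeff f m * ψ m + ∫ ψ (without f)
    ∫-without ψ []             = sym (trans (+-identityʳ _) (zeroˡ _))
    ∫-without ψ ((a , m′) ∷ f) with m′ ≟ m
    ... | yes ≡.refl = trans (+-congˡ (∫-without ψ f)) (trans (sym (+-assoc _ _ _)) (+-congʳ (sym (distribʳ _ _ _))))
    ... | no _       = begin
      a * ψ m′ + ∫ ψ f                                         ≈⟨ +-congˡ (∫-without ψ f) ⟩
      a * ψ m′ + (coeff f m * ψ m + ∫ ψ (without f))           ≈⟨ x∙yz≈y∙xz _ _ _ ⟩
      coeff f m * ψ m + (a * ψ m′ + ∫ ψ (without f))           ≈⟨ +-congʳ (*-congʳ (+-identityˡ _)) ⟨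
      (0# + coeff f m) * ψ m + (a * ψ m′ + ∫ ψ (without f))    ∎

    coeff-without-≡ : ∀ f → coeff (without f) m ≈ 0#
    coeff-without-≡ []             = refl
    coeff-without-≡ ((a , m′) ∷ f) with m′ ≟ m in eq
    ... | yes _ = coeff-without-≡ f
    ... | no _ rewrite eq = trans (+-identityˡ _) (coeff-without-≡ f)

    coeff-without-≢ : ∀ {m″} f → m″ ≢ m → coeff (without f) m″ ≈ coeff f m″
    coeff-without-≢      []             m″≢m = refl
    coeff-without-≢ {m″} ((a , m′) ∷ f) m″≢m with m′ ≟ m
    ... | no _       = +-congˡ (coeff-without-≢ f m″≢m)
    ... | yes ≡.refl with m ≟ m″
    ...   | yes eq = contradiction (≡.sym eq) m″≢m
    ...   | no _   = trans (coeff-without-≢ f m″≢m) (sym (+-identityˡ _))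

  -- As f may repeat monomials and equality in K is not decidable, the terms of f
  -- are split off one monomial at a time, collected into the coefficient.
  ∫-#0 : ∀ ψ (f : Polynomial n) → ∫ ψ f # 0# → ∃[ m ] coeff f m # 0# × ψ m # 0#
  ∫-#0 {n} ψ f = go f ℕ.≤-refl
    where
    go : ∀ {N} (f : Polynomial n) → List.length f ℕ.≤ N → ∫ ψ f # 0# → ∃[ m ] coeff f m # 0# × ψ m # 0#
    go []               _         0#0  = contradiction 0#0 (≈⇒¬# refl)
    go f@((_ , m) ∷ f′) (s≤s len) ∫#0 with +-#0 (#-congʳ (∫-without m ψ f) ∫#0)
    ... | inj₁ x#0 = m , *-#0 x#0
    ... | inj₂ y#0 with m′ , c#0 , ψ#0 ← go (without m f) (ℕ.≤-trans (length-without-∷ m f′) len) y#0 =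
      m′ , #-congʳ (coeff-without-≢ m f m′≢m) c#0 , ψ#0
      where
      m′≢m : m′ ≢ m
      m′≢m ≡.refl = ≈⇒¬# (coeff-without-≡ m f) c#0

  -- Coefficients, changes of monomials and binomials.

  coeff-+ : (f g : Polynomial n) (m : Monomial n) → coeff (f +ₚ g) m ≈ coeff f m + coeff g m
  coeff-+ f g m = trans (coeff-∫ (f +ₚ g) m) (trans (∫-+ _ f g) (+-cong (sym (coeff-∫ f m)) (sym (coeff-∫ g m))))

  coeff-neg : (f : Polynomial n) (m : Monomial n) → coeff (-ₚ f) m ≈ - coeff f m
  coeff-neg f m = trans (coeff-∫ (-ₚ f) m) (trans (∫-neg _ f) (-‿cong (sym (coeff-∫ f m))))

  -- If the functional took values on `f` and `g` whose difference is apart from 0, `∫-#0` would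
  -- produce a coefficient of f - g apart from 0. Tightness of apartness turns this refutation into
  -- equality.
  ∫-resp-≈ : ∀ ψ (f g : Polynomial n) → f ≈ₚ g → ∫ ψ f ≈ ∫ ψ g
  ∫-resp-≈ ψ f g f≈g = x∙y⁻¹≈ε⇒x≈y _ _
    (trans (sym (trans (∫-+ ψ f (-ₚ g)) (+-congˡ (∫-neg ψ g))))
    (¬#0⇒≈0 λ #0 → let m , c#0 , _ = ∫-#0 ψ (f +ₚ -ₚ g) #0 in ≈⇒¬# (vanishes m) c#0))
    where
    vanishes : ∀ m → coeff (f +ₚ -ₚ g) m ≈ 0#
    vanishes m = trans (coeff-+ f (-ₚ g) m) (trans (+-cong (f≈g m) (coeff-neg g m)) (-‿inverseʳ _))

  -- Coefficients are particular functionals. Identities between polynomials can thus be checked for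
  -- an arbitrary ψ, without comparing monomials.
  ∫≈⇒≈ₚ : (f g : Polynomial n) → (∀ ψ → ∫ ψ f ≈ ∫ ψ g) → f ≈ₚ g
  ∫≈⇒≈ₚ f g eq m = trans (coeff-∫ f m) (trans (eq _) (sym (coeff-∫ g m)))

  neg-cong : (f g : Polynomial n) → f ≈ₚ g → -ₚ f ≈ₚ -ₚ g
  neg-cong f g f≈g m = trans (coeff-neg f m) (trans (-‿cong (f≈g m)) (sym (coeff-neg g m)))

  mapMonomials-cong : (φ : Monomial n → Monomial k) (f g : Polynomial n) →
    f ≈ₚ g → mapMonomials φ f ≈ₚ mapMonomials φ g
  mapMonomials-cong φ f g f≈g = ∫≈⇒≈ₚ (mapMonomials φ f) (mapMonomials φ g) λ ψ →
    trans (reflexive (∫-map φ ψ f)) (trans (∫-resp-≈ (ψ ∘ φ) f g f≈g) (sym (reflexive (∫-map φ ψ g))))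

  mapMonomials-neg : (φ : Monomial n → Monomial k) (f : Polynomial n) →
    mapMonomials φ (-ₚ f) ≡ -ₚ mapMonomials φ f
  mapMonomials-neg φ []      = ≡.refl
  mapMonomials-neg φ (_ ∷ f) = cong (_ ∷_) (mapMonomials-neg φ f)

  coeff-mapMonomials-#0 : (φ : Monomial n → Monomial k) (f : Polynomial n) {m : Monomial k} →
    coeff (mapMonomials φ f) m # 0# → ∃[ m′ ] φ m′ ≡ m
  coeff-mapMonomials-#0 φ f {m} c#0
    with m′ , _ , ψ#0 ← ∫-#0 _ f (#-congʳ (trans (coeff-∫ (mapMonomials φ f) m) (reflexive (∫-map φ _ f))) c#0)
    = m′ , []₁-#0 (φ m′ ≟ m) ψ#0

  coeff-*-#0 : (g f : Polynomial n) {m : Monomial n} → coeff (g *ₚ f) m # 0# →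
    ∃[ m′ ] coeff f m′ # 0# × m′ ⊑ m
  coeff-*-#0 []            f c#0 = contradiction c#0 (≈⇒¬# refl)
  coeff-*-#0 ((a , t) ∷ g) f {m} c#0
    with +-#0 (#-congʳ (trans (coeff-∫ (((a , t) ∷ g) *ₚ f) m) (∫-∷* _ a t g f)) c#0)
  ... | inj₂ y#0 = coeff-*-#0 g f (#-congʳ (sym (coeff-∫ (g *ₚ f) m)) y#0)
  ... | inj₁ x#0 with m′ , c′#0 , ψ#0 ← ∫-#0 _ f (proj₂ (*-#0 x#0)) =
    m′ , c′#0 , t , []₁-#0 (t · m′ ≟ m) ψ#0

  coeff-term : (a : Carrier) (m : Monomial n) → coeff (term a m) m ≈ a
  coeff-term a m = trans (+-identityʳ _) (trans (sym (*-[]₁ (m ≟ m) a))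
    (trans (*-congˡ ([]₁-true (m ≟ m) ≡.refl)) (*-identityʳ a)))

  coeff-term-#0 : (a : Carrier) (m : Monomial n) {m′ : Monomial n} → coeff (term a m) m′ # 0# → m ≡ m′
  coeff-term-#0 a m {m′} c#0 with m ≟ m′
  ... | yes eq = eq
  ... | no _   = contradiction c#0 (≈⇒¬# (+-identityʳ 0#))

  binomial : Monomial n → Monomial n → Polynomial n
  binomial a b = term 1# a +ₚ -ₚ term 1# b

  ∫-binomial : (ψ : Monomial n → Carrier) (a b : Monomial n) → ∫ ψ (binomial a b) ≈ ψ a - ψ b
  ∫-binomial ψ a b = +-cong (*-identityˡ _) (trans (+-identityʳ _) (-1*x≈-x (ψ b)))

  coeff-binomial : (a b m : Monomial n) → coeff (binomial a b) m ≈ [ a ≟ m ]₁ - [ b ≟ m ]₁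
  coeff-binomial a b m = trans (coeff-∫ (binomial a b) m) (∫-binomial _ a b)

  coeff-binomialˡ : {a b : Monomial n} → a ≢ b → coeff (binomial a b) a ≈ 1#
  coeff-binomialˡ {a = a} {b} a≢b = trans (coeff-binomial a b a) (trans
    (+-cong ([]₁-true (a ≟ a) ≡.refl) (-‿cong ([]₁-false (b ≟ a) (a≢b ∘ ≡.sym))))
    (x-0≈x 1#))

  coeff-binomialʳ : {a b : Monomial n} → a ≢ b → coeff (binomial a b) b ≈ - 1#
  coeff-binomialʳ {a = a} {b} a≢b = trans (coeff-binomial a b b) (trans
    (+-cong ([]₁-false (a ≟ b) a≢b) (-‿cong ([]₁-true (b ≟ b) ≡.refl)))
    (+-identityˡ _))

  coeff-binomial-#0 : (a b : Monomial n) {m : Monomial n} → coeff (binomial a b) m # 0# → m ≡ a ⊎ m ≡ b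
  coeff-binomial-#0 a b {m} c#0 with m ≟ a | m ≟ b
  ... | yes eq | _      = inj₁ eq
  ... | no _   | yes eq = inj₂ eq
  ... | no m≢a | no m≢b = contradiction c#0 (≈⇒¬# (trans (coeff-binomial a b m) (trans
    (+-cong ([]₁-false (a ≟ m) (m≢a ∘ ≡.sym)) (-‿cong ([]₁-false (b ≟ m) (m≢b ∘ ≡.sym)))) (x-0≈x 0#))))

  binomial-swap : (a b : Monomial n) → binomial b a ≈ₚ -ₚ binomial a b
  binomial-swap a b = ∫≈⇒≈ₚ (binomial b a) (-ₚ binomial a b) λ ψ → begin
    ∫ ψ (binomial b a)      ≈⟨ ∫-binomial ψ b a ⟩
    ψ b - ψ a               ≈⟨ ⁻¹-anti-homo-// (ψ a) (ψ b) ⟨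
    - (ψ a - ψ b)           ≈⟨ -‿cong (∫-binomial ψ a b) ⟨
    - ∫ ψ (binomial a b)    ≈⟨ ∫-neg ψ (binomial a b) ⟨
    ∫ ψ (-ₚ binomial a b)   ∎

  -- The toric ideal and its grading.

  module _ (A : Matrix s n) where

    -- Both terms of a generator have the same weight. Multiplication by a monomial `t` only
    -- translates ψ by `weight A t`, which is why the induction keeps ψ arbitrary.
    ∫-toricGenerators : ∀ {f} → ⟨ toricGenerators A ⟩ f → ∀ ψ → ∫ (ψ ∘ weight A) f ≈ 0#
    ∫-toricGenerators (generator {f} (h , f≈)) ψ = trans
      (∫-resp-≈ (ψ ∘ weight A) f (binomial (unit h ++ 𝟙) (𝟙 ++ column A h)) f≈)
      (trans (∫-binomial (ψ ∘ weight A) (unit h ++ 𝟙) (𝟙 ++ column A h))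
      (x≈y⇒x∙y⁻¹≈ε (reflexive (cong ψ (≡.trans eq₁ (≡.sym eq₂))))))
      where
      eq₁ : weight A (unit h ++ 𝟙) ≡ column A h
      eq₁ = ≡.trans (weight-++ A (unit h) 𝟙) (≡.trans (·-identityʳ _) (degree-unit A h))
      eq₂ : weight A (𝟙 ++ column A h) ≡ column A h
      eq₂ = ≡.trans (weight-++ A 𝟙 _) (≡.trans (cong (_· column A h) (degree-𝟙 A)) (·-identityˡ _))
    ∫-toricGenerators (resp {f} {g} f≈g f∈) ψ =
      trans (sym (∫-resp-≈ (ψ ∘ weight A) f g f≈g)) (∫-toricGenerators f∈ ψ)
    ∫-toricGenerators zeroₚ ψ = refl
    ∫-toricGenerators (add {f} {g} f∈ g∈) ψ = trans (∫-+ (ψ ∘ weight A) f g)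
      (trans (+-cong (∫-toricGenerators f∈ ψ) (∫-toricGenerators g∈ ψ)) (+-identityˡ 0#))
    ∫-toricGenerators (multiply {f} g f∈) ψ = go g
      where
      go : ∀ g → ∫ (ψ ∘ weight A) (g *ₚ f) ≈ 0#
      go []            = refl
      go ((a , t) ∷ g) = trans (∫-∷* (ψ ∘ weight A) a t g f) (trans (+-cong
        (trans (*-congˡ (trans (∫-cong (λ m → reflexive (cong ψ (weight-· A t m))) f)
          (∫-toricGenerators f∈ (ψ ∘ (weight A t ·_))))) (zeroʳ a))
        (go g)) (+-identityˡ 0#))

    -- On monomials free of y the weight is the degree. With ψ the indicator of one degree, the
    -- coefficients of `f` in that degree sum to 0: this is the kernel of the map sending x_h to
    -- y^(column h).
    ∫-toricIdeal : ∀ {f} → toricIdeal A f → ∀ ψ → ∫ (ψ ∘ degree A) f ≈ 0#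
    ∫-toricIdeal {f} f∈ ψ = trans
      (∫-cong (λ m → reflexive (cong ψ (≡.sym (≡.trans (weight-++ A m 𝟙) (·-identityʳ _))))) f)
      (trans (reflexive (≡.sym (∫-map (_++ 𝟙) (ψ ∘ weight A) f))) (∫-toricGenerators f∈ ψ))

    toricIdeal-resp : ∀ f g → f ≈ₚ g → toricIdeal A f → toricIdeal A g
    toricIdeal-resp f g f≈g = resp (mapMonomials-cong (_++ 𝟙) f g f≈g)

    private
      infix 4 _~_
      _~_ : Monomial (n ℕ.+ s) → Monomial (n ℕ.+ s) → Set _
      a ~ b = ⟨ toricGenerators A ⟩ (binomial a b)

      ~-refl : ∀ a → a ~ a
      ~-refl a = resp (∫≈⇒≈ₚ [] (binomial a a) λ ψ →
        sym (trans (∫-binomial ψ a a) (-‿inverseʳ (ψ a)))) zeroₚ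

      ~-sym : ∀ {a b} → a ~ b → b ~ a
      ~-sym {a} {b} a~b = resp
        (∫≈⇒≈ₚ (term (- 1#) 𝟙 *ₚ binomial a b) (binomial b a) λ ψ → begin
          ∫ ψ (term (- 1#) 𝟙 *ₚ binomial a b)             ≈⟨ ∫-∷* ψ (- 1#) 𝟙 [] (binomial a b) ⟩
          - 1# * ∫ (ψ ∘ (𝟙 ·_)) (binomial a b) + 0#       ≈⟨ +-identityʳ _ ⟩
          - 1# * ∫ (ψ ∘ (𝟙 ·_)) (binomial a b)            ≈⟨ -1*x≈-x _ ⟩
          - ∫ (ψ ∘ (𝟙 ·_)) (binomial a b)                 ≈⟨ -‿cong (∫-cong (λ m → reflexive (cong ψ (·-identityˡ m))) (binomial a b)) ⟩
          - ∫ ψ (binomial a b)                            ≈⟨ ∫-neg ψ (binomial a b) ⟨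
          ∫ ψ (-ₚ binomial a b)                           ≈⟨ ∫-resp-≈ ψ (binomial b a) (-ₚ binomial a b) (binomial-swap a b) ⟨
          ∫ ψ (binomial b a)                              ∎)
        (multiply (term (- 1#) 𝟙) a~b)

      ~-trans : ∀ {a b c} → a ~ b → b ~ c → a ~ c
      ~-trans {a} {b} {c} a~b b~c = resp
        (∫≈⇒≈ₚ (binomial a b +ₚ binomial b c) (binomial a c) λ ψ → begin
          ∫ ψ (binomial a b +ₚ binomial b c)         ≈⟨ ∫-+ ψ (binomial a b) (binomial b c) ⟩
          ∫ ψ (binomial a b) + ∫ ψ (binomial b c)    ≈⟨ +-cong (∫-binomial ψ a b) (∫-binomial ψ b c) ⟩
          (ψ a - ψ b) + (ψ b - ψ c)                  ≈⟨ +-assoc _ _ _ ⟨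
          ((ψ a - ψ b) + ψ b) - ψ c                  ≈⟨ +-congʳ (//-rightDividesˡ (ψ b) (ψ a)) ⟩
          ψ a - ψ c                                  ≈⟨ ∫-binomial ψ a c ⟨
          ∫ ψ (binomial a c)                         ∎)
        (add a~b b~c)

      ~-·ˡ : ∀ t {a b} → a ~ b → t · a ~ t · b
      ~-·ˡ t {a} {b} a~b = resp
        (∫≈⇒≈ₚ (term 1# t *ₚ binomial a b) (binomial (t · a) (t · b)) λ ψ → begin
          ∫ ψ (term 1# t *ₚ binomial a b)             ≈⟨ ∫-∷* ψ 1# t [] (binomial a b) ⟩
          1# * ∫ (ψ ∘ (t ·_)) (binomial a b) + 0#     ≈⟨ +-identityʳ _ ⟩
          1# * ∫ (ψ ∘ (t ·_)) (binomial a b)          ≈⟨ *-identityˡ _ ⟩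
          ∫ (ψ ∘ (t ·_)) (binomial a b)               ≈⟨ ∫-binomial (ψ ∘ (t ·_)) a b ⟩
          ψ (t · a) - ψ (t · b)                       ≈⟨ ∫-binomial ψ (t · a) (t · b) ⟨
          ∫ ψ (binomial (t · a) (t · b))              ∎)
        (multiply (term 1# t) a~b)

      -- Each generator replaces one x_h by its monomial in y, so the induction multiplies by one
      -- indeterminate at a time.
      ~-degree : ∀ m → m ++ 𝟙 ~ 𝟙 ++ degree A m
      ~-degree = monomial-induction _
        (subst (λ d → 𝟙 {n} ++ 𝟙 ~ 𝟙 ++ d) (≡.sym (degree-𝟙 A)) (~-refl (𝟙 {n} ++ 𝟙)))
        λ h {m} m~ → ~-trans
          (subst₂ _~_ (≡.trans (·-++ (unit h) m 𝟙 𝟙) (cong (unit h · m ++_) (·-identityˡ 𝟙))) ≡.refl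
            (~-·ˡ (unit h ++ 𝟙) m~))
          (subst₂ _~_
            (·-comm (𝟙 ++ degree A m) (unit h ++ 𝟙))
            (≡.trans (·-++ (𝟙 {n}) 𝟙 (degree A m) (column A h)) (cong₂ _++_ (·-identityˡ 𝟙) (≡.trans (·-comm _ (column A h))
              (≡.sym (≡.trans (degree-· A (unit h) m) (cong (_· degree A m) (degree-unit A h)))))))
            (~-·ˡ (𝟙 ++ degree A m) (generator (h , λ _ → refl))))

    -- Both monomials are congruent to the same monomial in y, and their difference involves no y,
    -- so it lies in the elimination ideal.
    binomial∈toricIdeal : ∀ {a b} → degree A a ≡ degree A b → toricIdeal A (binomial a b)
    binomial∈toricIdeal {a} {b} eq =
      ~-trans (~-degree a) (subst (λ d → 𝟙 ++ d ~ b ++ 𝟙) (≡.sym eq) (~-sym (~-degree b)))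

    -- The coefficients in the degree of `m` sum to 0, so those at the other monomials of that
    -- degree sum to minus `coeff f m`, which is apart from 0. `∫-#0` then names one that
    -- contributes.
    toricIdeal-partner : ∀ f {m} → toricIdeal A f → coeff f m # 0# →
      ∃[ m′ ] coeff f m′ # 0# × degree A m′ ≡ degree A m × m′ ≢ m
    toricIdeal-partner f {m} f∈ c#0 =
      let m′ , c′#0 , ψ#0 = ∫-#0 others f others#0
          eq , m′≢m = []₁-#0 (other? m′) ψ#0
      in m′ , c′#0 , eq , m′≢m
      where
      other? = λ m′ → Vec.≡-dec ℕ._≟_ (degree A m′) (degree A m) ×-dec ¬? (m′ ≟ m)
      others : Monomial n → Carrier
      others m′ = [ other? m′ ]₁
      split : ∀ m′ → [ degree A m′ ≟ degree A m ]₁ ≈ [ m′ ≟ m ]₁ + others m′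
      split m′ with degree A m′ ≟ degree A m | m′ ≟ m
      ... | yes _ | yes _      = sym (+-identityʳ 1#)
      ... | yes _ | no _       = sym (+-identityˡ 1#)
      ... | no _  | no _       = sym (+-identityˡ 0#)
      ... | no ¬eq | yes m′≡m  = contradiction (cong (degree A) m′≡m) ¬eq
      sum≈0 : coeff f m + ∫ others f ≈ 0#
      sum≈0 = begin
        coeff f m + ∫ others f                             ≈⟨ +-congʳ (coeff-∫ f m) ⟩
        ∫ (λ m′ → [ m′ ≟ m ]₁) f + ∫ others f              ≈⟨ ∫-+ψ _ others f ⟨
        ∫ (λ m′ → [ m′ ≟ m ]₁ + others m′) f               ≈⟨ ∫-cong split f ⟨
        ∫ (λ m′ → [ degree A m′ ≟ degree A m ]₁) f         ≈⟨ ∫-toricIdeal {f} f∈ (λ d → [ d ≟ degree A m ]₁) ⟩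
        0#                                                 ∎
      others#0 : ∫ others f # 0#
      others#0 = #-congʳ (sym (inverseʳ-unique _ _ sum≈0)) (-‿#0 c#0)

  -- Leading monomials and initial ideals.

  module _ {ℓ} (order : TermOrder n ℓ) where
    open TermOrderProperties order

    -- The ideal is generated by single terms, so each monomial in the support of a member is a
    -- multiple of one of the generating monomials. Tracking a coefficient apart from 0 through the
    -- derivation finds which one.
    leadingTerms-divisor : {S : Pred (Polynomial n) ℓ′} → ∀ p {m} → ⟨ leadingTerms order S ⟩ p → coeff p m # 0# →
      ∃[ f ] ∃[ m₀ ] S f × IsLeadingMonomial order f m₀ × m₀ ⊑ m
    leadingTerms-divisor _ {m} (generator (f , m₀ , f∈S , lead , p≈)) c#0
      with ≡.refl ← coeff-term-#0 _ m₀ {m} (#-congʳ (p≈ m) c#0) = f , m₀ , f∈S , lead , 𝟙 , ·-identityˡ m₀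
    leadingTerms-divisor _ {m} (resp {f} f≈g f∈) c#0 = leadingTerms-divisor f f∈ (#-congʳ (sym (f≈g m)) c#0)
    leadingTerms-divisor _ zeroₚ c#0 = contradiction c#0 (≈⇒¬# refl)
    leadingTerms-divisor _ {m} (add {f} {g} f∈ g∈) c#0 with +-#0 (#-congʳ (coeff-+ f g m) c#0)
    ... | inj₁ x#0 = leadingTerms-divisor f f∈ x#0
    ... | inj₂ y#0 = leadingTerms-divisor g g∈ y#0
    leadingTerms-divisor _ (multiply {f} g f∈) c#0
      with m′ , c′#0 , m′⊑m ← coeff-*-#0 g f c#0
      with f₀ , m₀ , f₀∈S , lead , m₀⊑m′ ← leadingTerms-divisor f f∈ c′#0 = f₀ , m₀ , f₀∈S , lead , ⊑-trans m₀⊑m′ m′⊑m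

    ⊑⇒∈leadingTerms : {S : Pred (Polynomial n) ℓ′} → ∀ {f m₀ m} (a : Carrier) → S f → IsLeadingMonomial order f m₀ →
      coeff f m₀ ≈ 1# → m₀ ⊑ m → ⟨ leadingTerms order S ⟩ (term a m)
    ⊑⇒∈leadingTerms {f = f} {m₀} a f∈S lead monic (t , ≡.refl) = resp
      (∫≈⇒≈ₚ (term a t *ₚ term (coeff f m₀) m₀) (term a (t · m₀)) λ ψ →
        +-congʳ (*-congʳ (trans (*-congˡ monic) (*-identityʳ a))))
      (multiply {f = term (coeff f m₀) m₀} (term a t) (generator (f , m₀ , f∈S , lead , λ _ → refl)))

    IsLeadingMonomial-resp : ∀ f g {m} → f ≈ₚ g → IsLeadingMonomial order f m → IsLeadingMonomial order g m
    IsLeadingMonomial-resp f g {m} f≈g (c#0 , above) =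
      #-congʳ (f≈g m) c#0 , λ m′ m≺m′ → trans (sym (f≈g m′)) (above m′ m≺m′)

    leading-maximal : ∀ f {m m′} → IsLeadingMonomial order f m → coeff f m′ # 0# → ¬ m ≺ m′
    leading-maximal f lead c#0 m≺m′ = ≈⇒¬# (proj₂ lead _ m≺m′) c#0

    leading-unique : ∀ f {m m′} → IsLeadingMonomial order f m → IsLeadingMonomial order f m′ → m ≡ m′
    leading-unique f {m} {m′} lead lead′ with compare m m′
    ... | tri≈ _ eq _ = eq
    ... | tri< lt _ _ = contradiction lt (leading-maximal f lead (proj₁ lead′))
    ... | tri> _ _ gt = contradiction gt (leading-maximal f lead′ (proj₁ lead))

    leading-greater : ∀ f {m m′} → IsLeadingMonomial order f m → coeff f m′ # 0# → m′ ≢ m → m′ ≺ m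
    leading-greater f lead c#0 m′≢m with ≢⇒≺⊎≻ m′≢m
    ... | inj₁ m′≺m = m′≺m
    ... | inj₂ m≺m′ = contradiction m≺m′ (leading-maximal f lead c#0)

    leading-partner : ∀ (A : Matrix s n) f {m} → toricIdeal A f → IsLeadingMonomial order f m →
      ∃[ m′ ] degree A m′ ≡ degree A m × m′ ≺ m
    leading-partner A f f∈ lead =
      let m′ , c′#0 , eq , m′≢m = toricIdeal-partner A f f∈ (proj₁ lead)
      in m′ , eq , leading-greater f lead c′#0 m′≢m

    leading-binomial : ∀ {a b} → b ≺ a → IsLeadingMonomial order (binomial a b) a
    leading-binomial {a} {b} b≺a = #-congʳ (sym (coeff-binomialˡ a≢b)) 1#0 ,
      λ m a≺m → ¬#0⇒≈0 λ c#0 → [ (λ { ≡.refl → irrefl ≡.refl a≺m }) , (λ { ≡.refl → asym a≺m b≺a }) ]′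
        (coeff-binomial-#0 a b c#0)
      where
      a≢b : a ≢ b
      a≢b eq = irrefl (≡.sym eq) b≺a

  ideal-⊆ : {S : Pred (Polynomial n) ℓ} {T : Pred (Polynomial n) ℓ′} →
    (∀ {f} → S f → ⟨ T ⟩ f) → ∀ {f} → ⟨ S ⟩ f → ⟨ T ⟩ f
  ideal-⊆ S⊆T (generator f∈)  = S⊆T f∈
  ideal-⊆ S⊆T (resp f≈g f∈)   = resp f≈g (ideal-⊆ S⊆T f∈)
  ideal-⊆ S⊆T zeroₚ           = zeroₚ
  ideal-⊆ S⊆T (add f∈ g∈)     = add (ideal-⊆ S⊆T f∈) (ideal-⊆ S⊆T g∈)
  ideal-⊆ S⊆T (multiply g f∈) = multiply g (ideal-⊆ S⊆T f∈)

  -- From a reduced Gröbner basis to a Graver family.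

  lawrenceBinomial : Monomial k → Monomial k → Polynomial (k ℕ.+ k)
  lawrenceBinomial u v = binomial (u ++ v) (v ++ u)

  dehomogenize-lawrenceBinomial : (u v : Monomial k) → dehomogenize (lawrenceBinomial u v) ≡ binomial u v
  dehomogenize-lawrenceBinomial {k} u v = cong₂ binomial
    (Vec.++-injectiveˡ _ u (Vec.take++drop≡id k (u ++ v)))
    (Vec.++-injectiveˡ _ v (Vec.take++drop≡id k (v ++ u)))

  lawrenceBinomial∈toricIdeal : (A : Matrix s k) {u v : Monomial k} → degree A u ≡ degree A v →
    toricIdeal (lawrence A) (lawrenceBinomial u v)
  lawrenceBinomial∈toricIdeal A {u} {v} eq =
    binomial∈toricIdeal (lawrence A) {u ++ v} {v ++ u} (degree-lawrence-swap A eq)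

  module _ (A : Matrix s k) (order : TermOrder (k ℕ.+ k) ℓ)
    {G : Fin r → Polynomial (k ℕ.+ k)}
    (isReduced : IsReducedGröbnerBasis order (toricIdeal (lawrence A)) G) where
    private
      module R = IsReducedGröbnerBasis isReduced
      open IsGröbnerBasis R.isGröbnerBasis
      open TermOrderProperties order

      Λ = lawrence A

      lm : Fin r → Monomial (k ℕ.+ k)
      lm i = proj₁ (R.monic i)

      lead : ∀ i → IsLeadingMonomial order (G i) (lm i)
      lead i = proj₁ (proj₂ (R.monic i))

      coeff-lm : ∀ i → coeff (G i) (lm i) ≈ 1#
      coeff-lm i = proj₂ (proj₂ (R.monic i))

      initial-divisor : ∀ f {m} → toricIdeal Λ f → IsLeadingMonomial order f m → ∃[ j ] lm j ⊑ m
      initial-divisor f {m} f∈ f-lead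
        with f′ , m₀ , (j , f′≈) , lead′ , m₀⊑m ← leadingTerms-divisor order (term (coeff f m) m)
          (proj₁ initial-ideal (generator (f , m , f∈ , f-lead , λ _ → refl)))
          (#-congʳ (sym (coeff-term (coeff f m) m)) (proj₁ f-lead))
        = j , subst (_⊑ m) (leading-unique order (G j) (IsLeadingMonomial-resp order f′ (G j) f′≈ lead′) (lead j)) m₀⊑m

      divisor′ : ∀ {a b} → degree A a ≡ degree A b → b ++ a ≺ a ++ b → ∃[ j ] lm j ⊑ a ++ b
      divisor′ {a} {b} eq lt = initial-divisor (lawrenceBinomial a b)
        (lawrenceBinomial∈toricIdeal A {a} {b} eq) (leading-binomial order {a ++ b} {b ++ a} lt)

      other-lm-⋢ : ∀ {i j m} → coeff (G i) m # 0# → j ≢ i → ¬ lm j ⊑ m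
      other-lm-⋢ {i} {j} {m} c#0 j≢i lm⊑m = R.reduced i m c#0
        (⊑⇒∈leadingTerms order {f = G j} 1# (j , j≢i , λ _ → refl) (lead j) (coeff-lm j) lm⊑m)

      abstract
        -- For `j ≢ i` reducedness forbids the divisibility. For `j ≡ i` a proper multiple of the
        -- leading monomial would exceed it in the order.
        lm-⊑-support⇒≡ : ∀ {i j m} → coeff (G i) m # 0# → lm j ⊑ m → lm j ≡ m × lm i ≡ m
        lm-⊑-support⇒≡ {i} {j} c#0 lm⊑m with j Fin.≟ i
        ... | no j≢i = contradiction lm⊑m (other-lm-⋢ c#0 j≢i)
        ... | yes ≡.refl with ⊑⇒≡⊎≺ lm⊑m
        ...   | inj₁ lm≡m = lm≡m , lm≡m
        ...   | inj₂ lm≺m = contradiction lm≺m (leading-maximal order (G i) (lead i) c#0)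

        -- Two monomials of G i of the same degree give a binomial whose leading
        -- monomial divides the larger one; by reducedness it is that of G i.
        larger-is-leading : ∀ i m m′ → coeff (G i) m # 0# → degree Λ m′ ≡ degree Λ m → m′ ≺ m →
          ∃₂ λ u v → degree A u ≡ degree A v × v ++ u ≺ u ++ v × m ≡ u ++ v × m′ ≡ v ++ u × lm i ≡ m
        larger-is-leading i m m′ c#0 eq m′≺m =
          let t , u , v , balanced , oriented , t·≡m , t·≡m′ = lawrence-exchange A order {m} {m′} eq m′≺m
              j , lm⊑ = divisor′ {u} {v} balanced oriented
              lmj≡m , lm≡m = lm-⊑-support⇒≡ {i} {j} c#0 (⊑-trans {b = u ++ v} lm⊑ (t , t·≡m))
              -- `m` is the leading monomial that divides `u ++ v`, and `u ++ v` divides `m`; hence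
              -- they agree and the common factor `t` is trivial.
              m≡ = ⊑-antisym (subst (_⊑ u ++ v) lmj≡m lm⊑) (t , t·≡m)
              t≡𝟙 = ·-identityˡ-unique t (u ++ v) (≡.trans t·≡m m≡)
          in u , v , balanced , oriented , m≡ ,
             ≡.trans (≡.sym t·≡m′) (≡.trans (cong (_· (v ++ u)) t≡𝟙) (·-identityˡ (v ++ u))) , lm≡m

        shape : ∀ i → ∃₂ λ u v → degree A u ≡ degree A v × v ++ u ≺ u ++ v × lm i ≡ u ++ v
        shape i =
          let m′ , eq , m′≺lm = leading-partner order Λ (G i) {lm i} (members i) (lead i)
          in Product.map₂ (Product.map₂ (Product.map₂ (Product.map₂ proj₁)))
               (larger-is-leading i (lm i) m′ (proj₁ (lead i)) eq m′≺lm)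

    U V : Fin r → Monomial k
    U i = proj₁ (shape i)
    V i = proj₁ (proj₂ (shape i))

    private
      balanced : ∀ i → degree A (U i) ≡ degree A (V i)
      balanced i = proj₁ (proj₂ (proj₂ (shape i)))

      oriented : ∀ i → V i ++ U i ≺ U i ++ V i
      oriented i = proj₁ (proj₂ (proj₂ (proj₂ (shape i))))

      lm≡ : ∀ i → lm i ≡ U i ++ V i
      lm≡ i = proj₂ (proj₂ (proj₂ (proj₂ (shape i))))

      U++V≢V++U : ∀ i → U i ++ V i ≢ V i ++ U i
      U++V≢V++U i eq = irrefl (≡.sym eq) (oriented i)

      -- Of `m` and a partner, the larger is the leading monomial of `G i` and the smaller is its
      -- swap, so `m` is one of the two.
      support : ∀ i {m} → coeff (G i) m # 0# → m ≡ U i ++ V i ⊎ m ≡ V i ++ U i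
      support i {m} c#0 =
        let m′ , c′#0 , eq , m′≢m = toricIdeal-partner Λ (G i) (members i) c#0
        in Sum.map
          (λ m′≺m → let _ , _ , _ , _ , _ , _ , lm≡m = larger-is-leading i m m′ c#0 eq m′≺m
                    in ≡.trans (≡.sym lm≡m) (lm≡ i))
          (λ m≺m′ → let u , v , _ , _ , m′≡ , m≡ , lm≡m′ = larger-is-leading i m′ m c′#0 (≡.sym eq) m≺m′
                        U≡ , V≡ = Vec.++-injective (U i) u (≡.trans (≡.sym (lm≡ i)) (≡.trans lm≡m′ m′≡))
                    in ≡.trans m≡ (≡.sym (cong₂ _++_ V≡ U≡)))
          (≢⇒≺⊎≻ m′≢m)

      smallerCoeff : Fin r → Carrier
      smallerCoeff i = coeff (G i) (V i ++ U i)

      reducedBasis≈twoTerms : ∀ i → G i ≈ₚ term 1# (U i ++ V i) +ₚ term (smallerCoeff i) (V i ++ U i)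
      reducedBasis≈twoTerms i m with U i ++ V i ≟ m | V i ++ U i ≟ m
      ... | yes eq | yes eq′ = contradiction (≡.trans eq (≡.sym eq′)) (U++V≢V++U i)
      ... | yes eq | no _    = trans (subst (λ m → coeff (G i) m ≈ 1#) (≡.trans (lm≡ i) eq) (coeff-lm i))
        (sym (trans (+-congˡ (+-identityˡ 0#)) (+-identityʳ 1#)))
      ... | no _   | yes eq′ = trans (reflexive (cong (coeff (G i)) (≡.sym eq′)))
        (sym (trans (+-identityˡ _) (+-identityʳ _)))
      ... | no ¬eq | no ¬eq′ = trans
        (¬#0⇒≈0 λ c#0 → [ ¬eq ∘ ≡.sym , ¬eq′ ∘ ≡.sym ]′ (support i c#0))
        (sym (trans (+-identityˡ _) (+-identityˡ _)))

      -- The functional of `const 1#` is evaluation at (1,...,1), where the toric ideal vanishes;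
      -- hence the two coefficients cancel.
      smallerCoeff≈-1 : ∀ i → smallerCoeff i ≈ - 1#
      smallerCoeff≈-1 i = inverseʳ-unique 1# e (begin
        1# + e                            ≈⟨ +-cong (*-identityʳ 1#) (trans (+-identityʳ _) (*-identityʳ e)) ⟨
        ∫ (const 1#) twoTerms             ≈⟨ ∫-resp-≈ (const 1#) (G i) twoTerms (reducedBasis≈twoTerms i) ⟨
        ∫ (const 1#) (G i)                ≈⟨ ∫-toricIdeal Λ {G i} (members i) (const 1#) ⟩
        0#                                ∎)
        where
        e = smallerCoeff i
        twoTerms = term 1# (U i ++ V i) +ₚ term e (V i ++ U i)

    reducedBasis≈lawrenceBinomial : ∀ i → G i ≈ₚ lawrenceBinomial (U i) (V i)
    reducedBasis≈lawrenceBinomial i m = trans (reducedBasis≈twoTerms i m)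
      (∫≈⇒≈ₚ (term 1# (U i ++ V i) +ₚ term (smallerCoeff i) (V i ++ U i)) (lawrenceBinomial (U i) (V i))
        (λ ψ → +-congˡ (+-congʳ (*-congʳ (smallerCoeff≈-1 i)))) m)

    reducedBasis-isGraverFamily : IsGraverFamily A order U V
    reducedBasis-isGraverFamily = record
      { balanced       = balanced
      ; oriented       = oriented
      ; divisor        = λ {a} {b} eq lt → let j , lm⊑ = divisor′ {a} {b} eq lt in
          j , ++-⊑⁻ {a = U j} {a} {V j} {b} (subst (_⊑ a ++ b) (lm≡ j) lm⊑)
      -- Reducedness concerns every term of `G i`: the leading one, with coefficient 1, gives
      -- `separated`, and the other one, with coefficient -1, gives `separated-swap`.
      ; separated      = λ {i} {j} j≢i (u⊑ , v⊑) → other-lm-⋢ {i}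
          (#-congʳ (sym (trans (reducedBasis≈lawrenceBinomial i _) (coeff-binomialˡ (U++V≢V++U i)))) 1#0)
          j≢i (subst (_⊑ _) (≡.sym (lm≡ j)) (++-⊑ {a = U j} {_} {V j} u⊑ v⊑))
      ; separated-swap = λ {i} {j} j≢i (u⊑ , v⊑) → other-lm-⋢ {i}
          (#-congʳ (sym (trans (reducedBasis≈lawrenceBinomial i _) (coeff-binomialʳ (U++V≢V++U i)))) (-‿#0 1#0))
          j≢i (subst (_⊑ _) (≡.sym (lm≡ j)) (++-⊑ {a = U j} {_} {V j} u⊑ v⊑))
      }

  -- From a Graver family to a reduced Gröbner basis.

  module _ {A : Matrix s k} {order : TermOrder (k ℕ.+ k) ℓ} {u v : Fin r → Monomial k}
    (graver : IsGraverFamily A order u v) where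
    private
      open IsGraverFamily graver
      open TermOrderProperties order
      Λ = lawrence A

      G : Fin r → Polynomial (k ℕ.+ k)
      G i = lawrenceBinomial (u i) (v i)

      lead : ∀ i → IsLeadingMonomial order (G i) (u i ++ v i)
      lead i = leading-binomial order (oriented i)

      monic : ∀ i → coeff (G i) (u i ++ v i) ≈ 1#
      monic i = coeff-binomialˡ λ eq → irrefl (≡.sym eq) (oriented i)

      divisor-of-larger : ∀ {m m′} → degree Λ m′ ≡ degree Λ m → m′ ≺ m → ∃[ i ] u i ++ v i ⊑ m
      divisor-of-larger {m} {m′} eq m′≺m =
        let t , a , b , balanced′ , oriented′ , t·≡m , _ = lawrence-exchange A order {m} {m′} eq m′≺m
            i , u⊑ , v⊑ = divisor {a} {b} balanced′ oriented′
        in i , ⊑-trans {b = a ++ b} (++-⊑ {a = u i} {a} {v i} {b} u⊑ v⊑) (t , t·≡m)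

      -- No S-polynomials are needed: the leading monomial of any member exceeds a partner of the
      -- same degree, and the exchange applied to these two supplies a pair to which `divisor`
      -- applies.
      initial-divisor : ∀ f {m} → toricIdeal Λ f → IsLeadingMonomial order f m → ∃[ i ] u i ++ v i ⊑ m
      initial-divisor f {m} f∈ f-lead =
        let m′ , eq , m′≺m = leading-partner order Λ f {m} f∈ f-lead
        in divisor-of-larger {m} {m′} eq m′≺m

      initial-⊆ : ∀ {t} → leadingTerms order (toricIdeal Λ) t → ⟨ leadingTerms order (λ f → ∃[ i ] f ≈ₚ G i) ⟩ t
      initial-⊆ (f , m , f∈ , f-lead , t≈) =
        let i , div = initial-divisor f {m} f∈ f-lead
        in resp (λ m → sym (t≈ m))
             (⊑⇒∈leadingTerms order {f = G i} (coeff f m) (i , λ _ → refl) (lead i) (monic i) div)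

      reduced : ∀ i m → coeff (G i) m # 0# →
        ¬ ⟨ leadingTerms order (λ f → ∃[ j ] j ≢ i × f ≈ₚ G j) ⟩ (term 1# m)
      reduced i m c#0 m∈
        with f , m₀ , (j , j≢i , f≈) , f-lead , m₀⊑m ←
          leadingTerms-divisor order (term 1# m) m∈ (#-congʳ (sym (coeff-term 1# m)) 1#0)
        with ≡.refl ← leading-unique order (G j) (IsLeadingMonomial-resp order f (G j) f≈ f-lead) (lead j)
        with coeff-binomial-#0 (u i ++ v i) (v i ++ u i) c#0
      ... | inj₁ ≡.refl = separated j≢i (++-⊑⁻ m₀⊑m)
      ... | inj₂ ≡.refl = separated-swap j≢i (++-⊑⁻ m₀⊑m)

    graverFamily-isReducedGröbnerBasis :
      IsReducedGröbnerBasis order (toricIdeal (lawrence A)) (λ i → lawrenceBinomial (u i) (v i))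
    graverFamily-isReducedGröbnerBasis = record
      { isGröbnerBasis = record
        { members       = members
        ; initial-ideal = ideal-⊆ initial-⊆ , ideal-⊆ λ
            { (f , m , (i , f≈) , f-lead , t≈) → generator
              (f , m , toricIdeal-resp Λ (G i) f (λ m → sym (f≈ m)) (members i) , f-lead , t≈) }
        }
      ; monic   = λ i → u i ++ v i , lead i , monic i
      ; reduced = reduced
      }
      where
      members : ∀ i → toricIdeal Λ (G i)
      members i = lawrenceBinomial∈toricIdeal A (balanced i)

  -- Polynomials up to sign and the removal of binomials.

  infix 4 _≈±_
  _≈±_ : Polynomial n → Polynomial n → Set ℓ₁
  f ≈± g = f ≈ₚ g ⊎ f ≈ₚ -ₚ g

  ≈±-respˡ : (f g h : Polynomial n) → f ≈ₚ g → g ≈± h → f ≈± h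
  ≈±-respˡ f g h f≈g = Sum.map (λ g≈h m → trans (f≈g m) (g≈h m)) (λ g≈h m → trans (f≈g m) (g≈h m))

  ≈±-respʳ : (f g h : Polynomial n) → g ≈ₚ h → f ≈± g → f ≈± h
  ≈±-respʳ f g h g≈h = Sum.map
    (λ f≈g m → trans (f≈g m) (g≈h m))
    (λ f≈-g m → trans (f≈-g m) (neg-cong g h g≈h m))

  ≈±-map : (φ : Monomial n → Monomial k) (f g : Polynomial n) → f ≈± g → mapMonomials φ f ≈± mapMonomials φ g
  ≈±-map φ f g (inj₁ f≈g)  = inj₁ (mapMonomials-cong φ f g f≈g)
  ≈±-map φ f g (inj₂ f≈-g) = inj₂ (subst (mapMonomials φ f ≈ₚ_) (mapMonomials-neg φ g)
    (mapMonomials-cong φ f (-ₚ g) f≈-g))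

  ≈±-#0 : (f g : Polynomial n) {m : Monomial n} → f ≈± g → coeff g m # 0# → coeff f m # 0#
  ≈±-#0 f g {m} (inj₁ f≈g)  c#0 = #-congʳ (sym (f≈g m)) c#0
  ≈±-#0 f g {m} (inj₂ f≈-g) c#0 = #-congʳ (sym (trans (f≈-g m) (coeff-neg g m))) (-‿#0 c#0)

  ≈±-binomial : (f : Polynomial n) {a b c d : Monomial n} → ≡⊎swap a b c d → f ≈± binomial a b → f ≈± binomial c d
  ≈±-binomial f         (inj₁ (≡.refl , ≡.refl)) f≈±                   = f≈±
  ≈±-binomial f {a} {b} (inj₂ (≡.refl , ≡.refl)) (inj₁ f≈)  = inj₂ λ m → trans (f≈ m) (binomial-swap b a m)
  ≈±-binomial f {a} {b} (inj₂ (≡.refl , ≡.refl)) (inj₂ f≈-) = inj₁ λ m → trans (f≈- m) (sym (binomial-swap a b m))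

  mapMonomials-restrict-extend : (p : Subset k) (f : Polynomial ∣ p ∣) →
    mapMonomials (restrict p) (mapMonomials (extend p) f) ≡ f
  mapMonomials-restrict-extend p []            = ≡.refl
  mapMonomials-restrict-extend p ((a , m) ∷ f) =
    cong₂ (λ m f → (a , m) ∷ f) (restrict-extend p m) (mapMonomials-restrict-extend p f)

  module _ (X₀ : Subset k) (S : Pred (Polynomial k) ℓ)
    {G : Fin r → Polynomial (k ℕ.+ k)} (S⇔G : ∀ f → S f ⇔ (∃[ i ] f ≈± dehomogenize (G i)))
    {u v : Fin r → Monomial k} (G≈ : ∀ i → G i ≈ₚ lawrenceBinomial (u i) (v i)) (u≢v : ∀ i → u i ≢ v i)
    {order′ : TermOrder (∣ ∁ X₀ ∣ ℕ.+ ∣ ∁ X₀ ∣) ℓ′} {ι : Fin n → Fin r} {u′ v′ : Fin n → Monomial ∣ ∁ X₀ ∣}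
    (restriction : IsRestriction (∁ X₀) order′ u v ι u′ v′) where
    private
      open IsRestriction restriction
      p = ∁ X₀

      dehomogenized : ∀ i → dehomogenize (G i) ≈ₚ binomial (u i) (v i)
      dehomogenized i = subst (dehomogenize (G i) ≈ₚ_) (dehomogenize-lawrenceBinomial (u i) (v i))
        (mapMonomials-cong (Vec.take _) (G i) (lawrenceBinomial (u i) (v i)) (G≈ i))

      ≈±-binomial-uv : ∀ f i → f ≈± dehomogenize (G i) → f ≈± binomial (u i) (v i)
      ≈±-binomial-uv f i = ≈±-respʳ f (dehomogenize (G i)) (binomial (u i) (v i)) (dehomogenized i)

      supportedBy : ∀ f {m} → ¬ (∃[ h ] h ∈ X₀ × Involves f h) → coeff f m # 0# → SupportedIn p m
      supportedBy f {m} ¬involves c#0 with extend p (restrict p m) ≟ m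
      ... | yes supp  = supp
      ... | no ¬supp with h , h∈ , pos ← unsupported X₀ m ¬supp =
        contradiction (h , h∈ , m , c#0 , pos) ¬involves

      -- As `u i ≢ v i`, the two terms do not cancel: up to sign their coefficients in `f` are 1 and
      -- -1, so both monomials really occur and must avoid X₀.
      supported-uv : ∀ f i → f ≈± binomial (u i) (v i) → ¬ (∃[ h ] h ∈ X₀ × Involves f h) → Supported p u v i
      supported-uv f i f≈± ¬involves =
        supportedBy f ¬involves (≈±-#0 f (binomial (u i) (v i)) f≈± (#-congʳ (sym (coeff-binomialˡ (u≢v i))) 1#0)) ,
        supportedBy f ¬involves (≈±-#0 f (binomial (u i) (v i)) f≈± (#-congʳ (sym (coeff-binomialʳ (u≢v i))) (-‿#0 1#0)))

      -- Mapping monomials by `restrict p` substitutes 1 for each x_h with h in X₀. It undoes the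
      -- extension of `f′` and, being defined on all of K[x], can also be applied to the binomial.
      restrict-≈± : ∀ f f′ i → f ≈± binomial (u i) (v i) → f ≈ₚ mapMonomials (extend p) f′ →
        f′ ≈± binomial (restrict p (u i)) (restrict p (v i))
      restrict-≈± f f′ i f≈± f≈f′ = subst (_≈± binomial (restrict p (u i)) (restrict p (v i)))
        (mapMonomials-restrict-extend p f′)
        (≈±-respˡ (mapMonomials (restrict p) (mapMonomials (extend p) f′)) (mapMonomials (restrict p) f)
          (binomial (restrict p (u i)) (restrict p (v i)))
          (mapMonomials-cong (restrict p) (mapMonomials (extend p) f′) f (λ m → sym (f≈f′ m)))
          (≈±-map (restrict p) f (binomial (u i) (v i)) f≈±))

      ≈±-restricted : ∀ f′ i i′ → ι i′ ≡ i → f′ ≈± binomial (restrict p (u i)) (restrict p (v i)) →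
        f′ ≈± dehomogenize (lawrenceBinomial (u′ i′) (v′ i′))
      ≈±-restricted f′ i i′ ≡.refl f′≈± = subst (f′ ≈±_) (≡.sym (dehomogenize-lawrenceBinomial (u′ i′) (v′ i′)))
        (≈±-binomial f′ (restricts i′) f′≈±)

      to : ∀ f′ → removeInvolving X₀ S f′ → ∃[ i′ ] f′ ≈± dehomogenize (lawrenceBinomial (u′ i′) (v′ i′))
      to f′ (f , f∈S , ¬involves , f≈f′) =
        let i , f≈±G = Equivalence.to (S⇔G f) f∈S
            f≈± = ≈±-binomial-uv f i f≈±G
            i′ , ι≡ = complete i (supported-uv f i f≈± ¬involves)
        in i′ , ≈±-restricted f′ i i′ ι≡ (restrict-≈± f f′ i f≈± f≈f′)

      extend-≈± : ∀ f′ i′ → f′ ≈± dehomogenize (lawrenceBinomial (u′ i′) (v′ i′)) →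
        mapMonomials (extend p) f′ ≈± dehomogenize (G (ι i′))
      extend-≈± f′ i′ f′≈± = ≈±-respʳ f (binomial (u (ι i′)) (v (ι i′))) (dehomogenize (G (ι i′)))
        (λ m → sym (dehomogenized (ι i′) m))
        (≈±-binomial f (≡⊎swap-sym (extends i′)) (≈±-map (extend p) f′ (binomial (u′ i′) (v′ i′))
          (subst (f′ ≈±_) (dehomogenize-lawrenceBinomial (u′ i′) (v′ i′)) f′≈±)))
        where f = mapMonomials (extend p) f′

      extend-¬involves : ∀ f′ → ¬ (∃[ h ] h ∈ X₀ × Involves (mapMonomials (extend p) f′) h)
      extend-¬involves f′ (h , h∈ , m , c#0 , pos) with w , ≡.refl ← coeff-mapMonomials-#0 (extend p) f′ c#0 =
        ℕ.<-irrefl (≡.sym (lookup-extend-∁ X₀ w h∈)) pos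

    removeInvolving⇔ : ∀ f′ → removeInvolving X₀ S f′ ⇔
      (∃[ i′ ] f′ ≈± dehomogenize (lawrenceBinomial (u′ i′) (v′ i′)))
    removeInvolving⇔ f′ = mk⇔ (to f′) λ (i′ , f′≈±) →
      mapMonomials (extend p) f′ , Equivalence.from (S⇔G _) (ι i′ , extend-≈± f′ i′ f′≈±) ,
      extend-¬involves f′ , λ _ → refl

  removeInvolving-isUniversalGröbnerBasis : ∀ {ℓ″} (A : Matrix s k) (X₀ : Subset k)
    (order : TermOrder (k ℕ.+ k) ℓ) (order′ : TermOrder (∣ ∁ X₀ ∣ ℕ.+ ∣ ∁ X₀ ∣) ℓ′)
    (S : Pred (Polynomial k) ℓ″) → IsUniversalGröbnerBasis A order S →
    IsUniversalGröbnerBasis (submatrix (∁ X₀) A) order′ (removeInvolving X₀ S)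
  removeInvolving-isUniversalGröbnerBasis {k = k} A X₀ order order′ S (r , G , isReduced , S⇔G) =
    let graver = reducedBasis-isGraverFamily A order isReduced
        n , ι , u′ , v′ , restriction = restriction-exists graver (∁ X₀) order′
    in n , (λ i′ → lawrenceBinomial (u′ i′) (v′ i′)) ,
       graverFamily-isReducedGröbnerBasis (restriction-isGraverFamily graver restriction) ,
       removeInvolving⇔ X₀ S {G = G} S⇔G (reducedBasis≈lawrenceBinomial A order isReduced)
         (λ i → SwapProperties.≺-swap⇒≢ {k = k} order (IsGraverFamily.oriented graver i)) restriction

open import Data.Nat.Base using (_+_)

theorem1 : ∀ {c ℓ₁ ℓ₂ ℓ₃ ℓ ℓ′ ℓ″ : Level} (ℝ : RealField c ℓ₁ ℓ₂ ℓ₃) →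
    let open Polynomials (RealField.heytingField ℝ) hiding (_+_) in
    ∀ {s k : ℕ} (A : Matrix s k) (b : Vec ℕ k) →
    let X₀ = structuralZeros b in
    let X′ = ∁ X₀ in
    (order : TermOrder (k + k) ℓ) (order′ : TermOrder (∣ X′ ∣ + ∣ X′ ∣) ℓ′) →
    (U : Pred (Polynomial k) ℓ″) →
    IsUniversalGröbnerBasis A order U →
    IsUniversalGröbnerBasis (submatrix X′ A) order′ (removeInvolving X₀ U)
theorem1 ℝ A b order order′ U =
  removeInvolving-isUniversalGröbnerBasis (RealField.heytingField ℝ) A (structuralZeros b) order order′ U
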